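{- As $n\to\infty$, $$s(n)\le \frac{19}{6\ln 3}\,n\ln n+O(n).$$
   Context: A graph $G$ is universal for a class of graphs $\mathcal C$ if, up to isomorphism, $G$ contains every graph in $\mathcal C$ as a (not necessarily induced) subgraph. For $n\in\mathbb N$, $s(n)$ denotes the minimum number of edges in a graph with $n$ vertices that is universal for the class of all trees with $n$ vertices. -}

module Defs where

open import Data.Bool using (Bool; false; not; T)
open import Data.Bool.Properties using (T?)
open import Data.Fin as Fin using (Fin; inject₁; fromℕ)
import Data.Fin.Properties as Fin
open import Data.Integer as ℤ using (+_; +[1+_]; -[1+_])
import Data.Integer.Properties as ℤ
open import Data.List using (length; filter; allFin; cartesianProduct)
open import Data.Nat as ℕ using (ℕ; zero; suc; pred; s≤s; z≤n)
import Data.Nat.Properties as ℕ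
import Data.Nat.Solver as ℕ
open import Data.Product using (Σ; ∃-syntax; _×_; _,_)
open import Data.Rational as ℚ using (ℚ; mkℚ; 0ℚ; 1ℚ; ½; ∣_∣; _/_)
import Data.Rational.Properties as ℚ
import Data.Rational.Solver as ℚ
import Data.Rational.Unnormalised as ℚᵘ
import Data.Rational.Unnormalised.Properties as ℚᵘ
open import Data.Sum using (inj₁; inj₂)
open import Function.Definitions using (Injective)
open import Level using (0ℓ)
open import Relation.Binary.Construct.Closure.ReflexiveTransitive using (Star)
open import Relation.Binary.PropositionalEquality
open import Relation.Nullary using (¬_; yes; no; contradiction)
open import Relation.Nullary.Decidable using (_×-dec_; ⌊_⌋)
open import Relation.Unary using (Pred)

record Graph (n : ℕ) : Set where
  field
    adj    : Fin n → Fin n → Bool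
    symm   : ∀ u v → adj u v ≡ adj v u
    irrefl : ∀ v → adj v v ≡ false

  Adj : Fin n → Fin n → Set
  Adj u v = T (adj u v)

open Graph using (adj; Adj)

edgeCount : ∀ {n} → Graph n → ℕ
edgeCount {n} G =
  length (filter (λ (u , v) → (u Fin.<? v) ×-dec T? (adj G u v))
                 (cartesianProduct (allFin n) (allFin n)))

Connected : ∀ {n} → Graph n → Set
Connected G = ∀ u v → Star (Adj G) u v

record Cycle {n} (G : Graph n) : Set where
  field
    len-3    : ℕ
    vertex   : Fin (3 ℕ.+ len-3) → Fin n
    distinct : Injective _≡_ _≡_ vertex
    step     : ∀ i → Adj G (vertex (inject₁ i)) (vertex (Fin.suc i))
    close    : Adj G (vertex (fromℕ (2 ℕ.+ len-3))) (vertex Fin.zero)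

record IsTree {n} (G : Graph n) : Set where
  field
    nonempty  : ℕ.NonZero n
    connected : Connected G
    acyclic   : ¬ Cycle G

infix 4 _⊑_

-- H is isomorphic to a (not necessarily induced) subgraph of G.
_⊑_ : ∀ {k n} → Graph k → Graph n → Set
_⊑_ {k} {n} H G =
  ∃[ f ] Injective {A = Fin k} {B = Fin n} _≡_ _≡_ f
       × (∀ u v → Adj H u v → Adj G (f u) (f v))

Universal : ∀ {n} → Pred (Σ ℕ Graph) 0ℓ → Graph n → Set
Universal 𝒞 G = ∀ {k} (H : Graph k) → 𝒞 (k , H) → H ⊑ G

TreesOn : ℕ → Pred (Σ ℕ Graph) 0ℓ
TreesOn n (k , H) = k ≡ n × IsTree H

IsMinimum : Pred ℕ 0ℓ → ℕ → Set
IsMinimum P m = P m × (∀ k → P k → m ℕ.≤ k)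

UniversalSize : ℕ → Pred ℕ 0ℓ
UniversalSize n e = Σ (Graph n) λ G → Universal (TreesOn n) G × edgeCount G ≡ e

-- The graph of the function s. A minimum, when it exists, is unique; that it
-- exists classically is s-exists.
s[_]≡_ : ℕ → ℕ → Set
s[ n ]≡ m = IsMinimum (UniversalSize n) m

s-unique : ∀ {n m m′} → s[ n ]≡ m → s[ n ]≡ m′ → m ≡ m′
s-unique {m = m} {m′} (P , least) (P′ , least′) = ℕ.≤-antisym (least m′ P′) (least′ m P)

complete : ∀ n → Graph n
complete n = record
  { adj  = λ u v → not ⌊ u Fin.≟ v ⌋
  ; symm = symmetric
  ; irrefl = irreflexive
  }
  where
  symmetric : (u v : Fin n) → not ⌊ u Fin.≟ v ⌋ ≡ not ⌊ v Fin.≟ u ⌋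
  symmetric u v with u Fin.≟ v | v Fin.≟ u
  ... | yes _   | yes _   = refl
  ... | no  _   | no  _   = refl
  ... | yes u≡v | no v≢u  = contradiction (sym u≡v) v≢u
  ... | no u≢v  | yes v≡u = contradiction (sym v≡u) u≢v

  irreflexive : (v : Fin n) → not ⌊ v Fin.≟ v ⌋ ≡ false
  irreflexive v with v Fin.≟ v
  ... | yes _  = refl
  ... | no v≢v = contradiction refl v≢v

complete-universal : ∀ n → Universal (TreesOn n) (complete n)
complete-universal n H (refl , _) = (λ v → v) , (λ eq → eq) , embed
  where
  embed : ∀ u v → Adj H u v → Adj (complete n) u v
  embed u v uv with u Fin.≟ v
  ... | no _     = _
  ... | yes refl = subst T (Graph.irrefl H u) uv

s-exists : ∀ n → ¬ ¬ (∃[ m ] s[ n ]≡ m)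
s-exists n noMin = noneBelow (suc e) e ℕ.≤-refl (complete n , complete-universal n , refl)
  where
  e = edgeCount (complete n)
  noneBelow : ∀ b k → k ℕ.< b → ¬ UniversalSize n k
  noneBelow (suc b) k (s≤s k≤b) Pk = noMin (k , Pk , λ j Pj →
    ℕ.≮⇒≥ λ j<k → noneBelow b j (ℕ.<-≤-trans j<k k≤b) Pj)

IsCauchy : (ℕ → ℚ) → Set
IsCauchy x = ∀ ε → 0ℚ ℚ.< ε →
  ∃[ N ] (∀ i j → N ℕ.≤ i → N ℕ.≤ j → ∣ x i ℚ.- x j ∣ ℚ.< ε)

record ℝ : Set where
  constructor mkℝ
  field
    seq    : ℕ → ℚ
    cauchy : IsCauchy seq

open ℝ public

infix 4 _≤ᴿ_

_≤ᴿ_ : ℝ → ℝ → Set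
x ≤ᴿ y = ∀ ε → 0ℚ ℚ.< ε →
  ∃[ N ] (∀ k → N ℕ.≤ k → seq x k ℚ.≤ seq y k ℚ.+ ε)

private
  ≤-left : ∀ m n {o} → m ℕ.⊔ n ℕ.≤ o → m ℕ.≤ o
  ≤-left m n = ℕ.m⊔n≤o⇒m≤o m n

  ≤-right : ∀ m n {o} → m ℕ.⊔ n ℕ.≤ o → n ℕ.≤ o
  ≤-right m n = ℕ.m⊔n≤o⇒n≤o m n

  ½-pos : ∀ {ε} → 0ℚ ℚ.< ε → 0ℚ ℚ.< ½ ℚ.* ε
  ½-pos {ε} ε>0 = ℚ.positive⁻¹ (½ ℚ.* ε)
    {{ℚ.pos*pos⇒pos ½ ε {{ℚ.positive ε>0}}}}

  ½+½ : ∀ ε → ½ ℚ.* ε ℚ.+ ½ ℚ.* ε ≡ ε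
  ½+½ ε = trans (sym (ℚ.*-distribʳ-+ ε ½ ½)) (ℚ.*-identityˡ ε)

  -- B · scale = ε
  module Scale {B ε : ℚ} (B>0 : 0ℚ ℚ.< B) (ε>0 : 0ℚ ℚ.< ε) where
    instance
      B⁺ : ℚ.Positive B
      B⁺ = ℚ.positive B>0
      ε⁺ : ℚ.Positive ε
      ε⁺ = ℚ.positive ε>0
      B≢0 : ℚ.NonZero B
      B≢0 = ℚ.pos⇒nonZero B

    scale : ℚ
    scale = ℚ.1/ B ℚ.* ε

    scale>0 : 0ℚ ℚ.< scale
    scale>0 = ℚ.positive⁻¹ scale
      {{ℚ.pos*pos⇒pos (ℚ.1/ B) {{ℚ.1/pos⇒pos B}} ε}}

    B*scale : B ℚ.* scale ≡ ε
    B*scale = trans (sym (ℚ.*-assoc B (ℚ.1/ B) ε))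
             (trans (cong (ℚ._* ε) (ℚ.*-inverseʳ B)) (ℚ.*-identityˡ ε))

  *-mono-≤⁺ : ∀ {p q r t} → 0ℚ ℚ.≤ p → 0ℚ ℚ.≤ t → p ℚ.≤ q → r ℚ.≤ t →
              p ℚ.* r ℚ.≤ q ℚ.* t
  *-mono-≤⁺ {p} {q} {r} {t} 0≤p 0≤t p≤q r≤t = ℚ.≤-trans
    (ℚ.*-monoˡ-≤-nonNeg p {{ℚ.nonNegative 0≤p}} r≤t)
    (ℚ.*-monoʳ-≤-nonNeg t {{ℚ.nonNegative 0≤t}} p≤q)

  bounded : ∀ {x} → IsCauchy x →
            ∃[ B ] 0ℚ ℚ.< B × (∃[ N ] (∀ i → N ℕ.≤ i → ∣ x i ∣ ℚ.≤ B))
  bounded {x} cx with cx 1ℚ (ℚ.positive⁻¹ 1ℚ)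
  ... | N , close = B , B>0 , N , bound
    where
    B = 1ℚ ℚ.+ ∣ x N ∣
    B>0 : 0ℚ ℚ.< B
    B>0 = ℚ.+-mono-<-≤ (ℚ.positive⁻¹ 1ℚ) (ℚ.0≤∣p∣ (x N))
    split : ∀ a b → a ≡ (a ℚ.- b) ℚ.+ b
    split = solve 2 (λ a b → a := (a :- b) :+ b) refl
      where open ℚ.+-*-Solver
    bound : ∀ i → N ℕ.≤ i → ∣ x i ∣ ℚ.≤ B
    bound i N≤i = ℚ.≤-trans
      (subst (λ q → ∣ q ∣ ℚ.≤ ∣ x i ℚ.- x N ∣ ℚ.+ ∣ x N ∣)
             (sym (split (x i) (x N))) (ℚ.∣p+q∣≤∣p∣+∣q∣ (x i ℚ.- x N) (x N)))
      (ℚ.+-monoˡ-≤ ∣ x N ∣ (ℚ.<⇒≤ (close i N N≤i ℕ.≤-refl)))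

  const-cauchy : ∀ q → IsCauchy (λ _ → q)
  const-cauchy q ε ε>0 =
    0 , λ _ _ _ _ → subst (λ r → ∣ r ∣ ℚ.< ε) (sym (ℚ.+-inverseʳ q)) ε>0

  +-cauchy : ∀ {x y} → IsCauchy x → IsCauchy y → IsCauchy (λ k → x k ℚ.+ y k)
  +-cauchy {x} {y} cx cy ε ε>0
    with cx (½ ℚ.* ε) (½-pos ε>0) | cy (½ ℚ.* ε) (½-pos ε>0)
  ... | N , hx | M , hy = N ℕ.⊔ M , λ i j Ni Nj →
    ℚ.≤-<-trans
      (subst (λ q → ∣ q ∣ ℚ.≤ ∣ x i ℚ.- x j ∣ ℚ.+ ∣ y i ℚ.- y j ∣)
        (shuffle (x i) (x j) (y i) (y j))
        (ℚ.∣p+q∣≤∣p∣+∣q∣ (x i ℚ.- x j) (y i ℚ.- y j)))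
      (subst (_ ℚ.<_) (½+½ ε) (ℚ.+-mono-<
        (hx i j (≤-left N M Ni) (≤-left N M Nj))
        (hy i j (≤-right N M Ni) (≤-right N M Nj))))
    where
    shuffle : ∀ a b c d → (a ℚ.- b) ℚ.+ (c ℚ.- d) ≡ (a ℚ.+ c) ℚ.- (b ℚ.+ d)
    shuffle = solve 4 (λ a b c d → (a :- b) :+ (c :- d) := (a :+ c) :- (b :+ d)) refl
      where open ℚ.+-*-Solver

  product-close : ∀ {a b c d B C δ η ε} →
    0ℚ ℚ.< B → 0ℚ ℚ.< C → ∣ a ∣ ℚ.≤ B → ∣ d ∣ ℚ.≤ C →
    ∣ c ℚ.- d ∣ ℚ.< η → ∣ a ℚ.- b ∣ ℚ.< δ →
    B ℚ.* η ≡ ½ ℚ.* ε → C ℚ.* δ ≡ ½ ℚ.* ε →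
    ∣ a ℚ.* c ℚ.- b ℚ.* d ∣ ℚ.< ε
  product-close {a} {b} {c} {d} {B} {C} {δ} {η} {ε} B>0 C>0 a≤B d≤C c-d a-b Bη Cδ =
    subst (ℚ._< ε) (cong ∣_∣ (sym (shuffle a b c d)))
      (ℚ.≤-<-trans {j = S} (ℚ.∣p+q∣≤∣p∣+∣q∣ P Q)
        (subst (S ℚ.<_) (½+½ ε)
          (ℚ.+-mono-< {∣ P ∣} {½ ℚ.* ε} {∣ Q ∣} {½ ℚ.* ε}
            (term a (c ℚ.- d) B>0 a≤B c-d Bη) (term d (a ℚ.- b) C>0 d≤C a-b Cδ))))
    where
    P = a ℚ.* (c ℚ.- d)
    Q = d ℚ.* (a ℚ.- b)
    S = ∣ P ∣ ℚ.+ ∣ Q ∣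
    shuffle : ∀ a b c d →
      a ℚ.* c ℚ.- b ℚ.* d ≡ a ℚ.* (c ℚ.- d) ℚ.+ d ℚ.* (a ℚ.- b)
    shuffle = solve 4 (λ a b c d →
      a :* c :- b :* d := a :* (c :- d) :+ d :* (a :- b)) refl
      where open ℚ.+-*-Solver
    term : ∀ p q {E η e} → 0ℚ ℚ.< E → ∣ p ∣ ℚ.≤ E → ∣ q ∣ ℚ.< η → E ℚ.* η ≡ e →
           ∣ p ℚ.* q ∣ ℚ.< e
    term p q {E} {η} {e} E>0 p≤E q<η Eη = subst₂ ℚ._<_ (sym (ℚ.∣p*q∣≡∣p∣*∣q∣ p q)) Eη
      (ℚ.≤-<-trans {∣ p ∣ ℚ.* ∣ q ∣} {E ℚ.* ∣ q ∣} {E ℚ.* η}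
        (ℚ.*-monoʳ-≤-nonNeg ∣ q ∣ {{ℚ.∣-∣-nonNeg q}} {∣ p ∣} {E} p≤E)
        (ℚ.*-monoʳ-<-pos E {{ℚ.positive E>0}} {∣ q ∣} {η} q<η))

  *-cauchy : ∀ {x y} → IsCauchy x → IsCauchy y → IsCauchy (λ k → x k ℚ.* y k)
  *-cauchy {x} {y} cx cy ε ε>0 =
    let B , B>0 , N₁ , bx = bounded cx
        C , C>0 , N₂ , by = bounded cy
        N₃ , hx = cx (Scale.scale C>0 (½-pos ε>0)) (Scale.scale>0 C>0 (½-pos ε>0))
        N₄ , hy = cy (Scale.scale B>0 (½-pos ε>0)) (Scale.scale>0 B>0 (½-pos ε>0))
        ≥₁₂ : ∀ {o} → (N₁ ℕ.⊔ N₂) ℕ.⊔ (N₃ ℕ.⊔ N₄) ℕ.≤ o → N₁ ℕ.⊔ N₂ ℕ.≤ o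
        ≥₁₂ = ≤-left (N₁ ℕ.⊔ N₂) (N₃ ℕ.⊔ N₄)
        ≥₃₄ : ∀ {o} → (N₁ ℕ.⊔ N₂) ℕ.⊔ (N₃ ℕ.⊔ N₄) ℕ.≤ o → N₃ ℕ.⊔ N₄ ℕ.≤ o
        ≥₃₄ = ≤-right (N₁ ℕ.⊔ N₂) (N₃ ℕ.⊔ N₄)
    in (N₁ ℕ.⊔ N₂) ℕ.⊔ (N₃ ℕ.⊔ N₄) , λ i j Ni Nj →
      product-close {x i} {x j} {y i} {y j} B>0 C>0
        (bx i (≤-left N₁ N₂ (≥₁₂ Ni)))
        (by j (≤-right N₁ N₂ (≥₁₂ Nj)))
        (hy i j (≤-right N₃ N₄ (≥₃₄ Ni)) (≤-right N₃ N₄ (≥₃₄ Nj)))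
        (hx i j (≤-left N₃ N₄ (≥₃₄ Ni)) (≤-left N₃ N₄ (≥₃₄ Nj)))
        (Scale.B*scale B>0 (½-pos ε>0)) (Scale.B*scale C>0 (½-pos ε>0))

fromℕᴿ : ℕ → ℝ
fromℕᴿ n = mkℝ (λ _ → + n / 1) (const-cauchy (+ n / 1))

infixl 6 _+ᴿ_
infixl 7 _*ᴿ_ _÷ᴿ_

_+ᴿ_ : ℝ → ℝ → ℝ
x +ᴿ y = mkℝ (λ k → seq x k ℚ.+ seq y k) (+-cauchy {seq x} {seq y} (cauchy x) (cauchy y))

_*ᴿ_ : ℝ → ℝ → ℝ
x *ᴿ y = mkℝ (λ k → seq x k ℚ.* seq y k) (*-cauchy {seq x} {seq y} (cauchy x) (cauchy y))

-- The bound is required at every index, so that quotients can be taken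
-- termwise; every positive real has a representative of this kind.
record Positiveᴿ (x : ℝ) : Set where
  constructor mkPositive
  field
    bound   : ℚ
    bound>0 : 0ℚ ℚ.< bound
    bound≤  : ∀ k → bound ℚ.≤ seq x k

  seq-nonZero : ∀ k → ℚ.NonZero (seq x k)
  seq-nonZero k = ℚ.>-nonZero (ℚ.<-≤-trans bound>0 (bound≤ k))

private
  module Reciprocal (y : ℝ) (y>0 : Positiveᴿ y) where
    open Positiveᴿ y>0

    recip : ℕ → ℚ
    recip k = (ℚ.1/ seq y k) {{seq-nonZero k}}

    recip>0 : ∀ k → 0ℚ ℚ.< recip k
    recip>0 k = ℚ.positive⁻¹ (recip k) {{ℚ.1/pos⇒pos (seq y k)
      {{ℚ.positive (ℚ.<-≤-trans bound>0 (bound≤ k))}}}}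

    instance
      b⁺ : ℚ.Positive bound
      b⁺ = ℚ.positive bound>0
      b≢0 : ℚ.NonZero bound
      b≢0 = ℚ.pos⇒nonZero bound

    B : ℚ
    B = ℚ.1/ bound

    B>0 : 0ℚ ℚ.< B
    B>0 = ℚ.positive⁻¹ B {{ℚ.1/pos⇒pos bound}}

    recip≤B : ∀ k → recip k ℚ.≤ B
    recip≤B k = ℚ.*-cancelʳ-≤-pos bound (begin
      recip k ℚ.* bound   ≤⟨ ℚ.*-monoˡ-≤-nonNeg (recip k)
                               {{ℚ.nonNegative (ℚ.<⇒≤ (recip>0 k))}} (bound≤ k) ⟩
      recip k ℚ.* seq y k ≡⟨ ℚ.*-inverseˡ (seq y k) {{seq-nonZero k}} ⟩
      1ℚ                  ≡⟨ sym (ℚ.*-inverseˡ bound) ⟩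
      B ℚ.* bound         ∎)
      where open ℚ.≤-Reasoning

    BB>0 : 0ℚ ℚ.< B ℚ.* B
    BB>0 = ℚ.positive⁻¹ (B ℚ.* B)
      {{ℚ.pos*pos⇒pos B {{ℚ.positive B>0}} B {{ℚ.positive B>0}}}}

    difference : ∀ i j →
      recip i ℚ.- recip j ≡ (recip i ℚ.* recip j) ℚ.* (seq y j ℚ.- seq y i)
    difference i j = begin
      r ℚ.- t                                 ≡⟨ cong₂ ℚ._-_ (sym (ℚ.*-identityʳ r)) (sym (ℚ.*-identityʳ t)) ⟩
      r ℚ.* 1ℚ ℚ.- t ℚ.* 1ℚ                   ≡⟨ cong₂ (λ a b → r ℚ.* a ℚ.- t ℚ.* b)
                                                   (sym (ℚ.*-inverseˡ (seq y j) {{seq-nonZero j}}))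
                                                   (sym (ℚ.*-inverseˡ (seq y i) {{seq-nonZero i}})) ⟩
      r ℚ.* (t ℚ.* b) ℚ.- t ℚ.* (r ℚ.* a)     ≡⟨ shuffle r t a b ⟩
      (r ℚ.* t) ℚ.* (b ℚ.- a)                 ∎
      where
      open ≡-Reasoning
      r = recip i
      t = recip j
      a = seq y i
      b = seq y j
      shuffle : ∀ r t a b → r ℚ.* (t ℚ.* b) ℚ.- t ℚ.* (r ℚ.* a) ≡ (r ℚ.* t) ℚ.* (b ℚ.- a)
      shuffle = solve 4 (λ r t a b →
        r :* (t :* b) :- t :* (r :* a) := (r :* t) :* (b :- a)) refl
        where open ℚ.+-*-Solver

    recip-cauchy : IsCauchy recip
    recip-cauchy ε ε>0
      with cauchy y (Scale.scale BB>0 ε>0) (Scale.scale>0 BB>0 ε>0)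
    ... | N , hy = N , λ i j Ni Nj → begin-strict
      ∣ recip i ℚ.- recip j ∣
        ≡⟨ cong ∣_∣ (difference i j) ⟩
      ∣ (recip i ℚ.* recip j) ℚ.* (seq y j ℚ.- seq y i) ∣
        ≡⟨ ℚ.∣p*q∣≡∣p∣*∣q∣ (recip i ℚ.* recip j) (seq y j ℚ.- seq y i) ⟩
      ∣ recip i ℚ.* recip j ∣ ℚ.* ∣ seq y j ℚ.- seq y i ∣
        ≡⟨ cong (ℚ._* ∣ seq y j ℚ.- seq y i ∣) (ℚ.0≤p⇒∣p∣≡p (ℚ.<⇒≤ (rr>0 i j))) ⟩
      (recip i ℚ.* recip j) ℚ.* ∣ seq y j ℚ.- seq y i ∣
        ≤⟨ ℚ.*-monoʳ-≤-nonNeg ∣ seq y j ℚ.- seq y i ∣ {{ℚ.∣-∣-nonNeg (seq y j ℚ.- seq y i)}}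
             (*-mono-≤⁺ (ℚ.<⇒≤ (recip>0 i)) (ℚ.<⇒≤ B>0) (recip≤B i) (recip≤B j)) ⟩
      (B ℚ.* B) ℚ.* ∣ seq y j ℚ.- seq y i ∣
        <⟨ ℚ.*-monoʳ-<-pos (B ℚ.* B) {{ℚ.positive BB>0}} (hy j i Nj Ni) ⟩
      (B ℚ.* B) ℚ.* Scale.scale BB>0 ε>0
        ≡⟨ Scale.B*scale BB>0 ε>0 ⟩
      ε ∎
      where
      open ℚ.≤-Reasoning
      rr>0 : ∀ i j → 0ℚ ℚ.< recip i ℚ.* recip j
      rr>0 i j = ℚ.positive⁻¹ (recip i ℚ.* recip j)
        {{ℚ.pos*pos⇒pos (recip i) {{ℚ.positive (recip>0 i)}}
                        (recip j) {{ℚ.positive (recip>0 j)}}}}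

_÷ᴿ_ : ℝ → (y : ℝ) → {{Positiveᴿ y}} → ℝ
_÷ᴿ_ x y {{y>0}} = mkℝ
  (λ k → (seq x k ℚ.÷ seq y k) {{Positiveᴿ.seq-nonZero y>0 k}})
  (*-cauchy {seq x} {Reciprocal.recip y y>0} (cauchy x) (Reciprocal.recip-cauchy y y>0))

-- 1/(a+1) + … + 1/(a+l)
sumRecip : ℕ → ℕ → ℚ
sumRecip a zero    = 0ℚ
sumRecip a (suc l) = + 1 / suc a ℚ.+ sumRecip (suc a) l

-- With M = k + 1, the right Riemann sum of mesh 1/M for ∫₁ⁿ dt/t:
-- Σ_{j=1}^{(n-1)M} (1/M) · 1/(1 + j/M) = Σ_{j=1}^{(n-1)M} 1/(M + j).
lnSeq : ℕ → ℕ → ℚ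
lnSeq n k = sumRecip (suc k) (pred n ℕ.* suc k)

private
  toℚᵘ-frac : ∀ a b → ℚ.toℚᵘ (+ a / suc b) ℚᵘ.≃ ℚᵘ.mkℚᵘ (+ a) b
  toℚᵘ-frac a b = ℚ.toℚᵘ-fromℚᵘ (ℚᵘ.mkℚᵘ (+ a) b)

  frac-≤ : ∀ a b c d → a ℕ.* suc d ℕ.≤ c ℕ.* suc b →
           + a / suc b ℚ.≤ + c / suc d
  frac-≤ a b c d le = ℚ.toℚᵘ-cancel-≤
    (ℚᵘ.≤-respˡ-≃ (ℚᵘ.≃-sym (toℚᵘ-frac a b))
    (ℚᵘ.≤-respʳ-≃ (ℚᵘ.≃-sym (toℚᵘ-frac c d))
      (ℚᵘ.*≤* (subst₂ ℤ._≤_ (ℤ.pos-* a (suc d)) (ℤ.pos-* c (suc b)) (ℤ.+≤+ le)))))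

  frac-suc : ∀ a d → + suc a / suc d ≡ + 1 / suc d ℚ.+ + a / suc d
  frac-suc a d = ℚ.toℚᵘ-injective (begin
    ℚ.toℚᵘ (+ suc a / suc d)                          ≈⟨ toℚᵘ-frac (suc a) d ⟩
    ℚᵘ.mkℚᵘ (+ suc a) d                               ≈⟨ ℚᵘ.*≡* eq ⟩
    ℚᵘ.mkℚᵘ (+ 1) d ℚᵘ.+ ℚᵘ.mkℚᵘ (+ a) d              ≈⟨ ℚᵘ.+-cong (ℚᵘ.≃-sym (toℚᵘ-frac 1 d)) (ℚᵘ.≃-sym (toℚᵘ-frac a d)) ⟩
    ℚ.toℚᵘ (+ 1 / suc d) ℚᵘ.+ ℚ.toℚᵘ (+ a / suc d)    ≈⟨ ℚᵘ.≃-sym (ℚ.toℚᵘ-homo-+ (+ 1 / suc d) (+ a / suc d)) ⟩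
    ℚ.toℚᵘ (+ 1 / suc d ℚ.+ + a / suc d)              ∎)
    where
    open ℚᵘ.≃-Reasoning
    natEq : suc a ℕ.* (suc d ℕ.* suc d) ≡ (1 ℕ.* suc d ℕ.+ a ℕ.* suc d) ℕ.* suc d
    natEq = solve 2 (λ a D → (con 1 :+ a) :* (D :* D) := (con 1 :* D :+ a :* D) :* D)
              refl a (suc d)
      where open ℕ.+-*-Solver
    eq : + suc a ℤ.* + (suc d ℕ.* suc d) ≡ (+ 1 ℤ.* + suc d ℤ.+ + a ℤ.* + suc d) ℤ.* + suc d
    eq = trans (sym (ℤ.pos-* (suc a) (suc d ℕ.* suc d)))
        (trans (cong +_ natEq)
        (trans (ℤ.pos-* (1 ℕ.* suc d ℕ.+ a ℕ.* suc d) (suc d))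
               (cong (ℤ._* + suc d)
                 (trans (ℤ.pos-+ (1 ℕ.* suc d) (a ℕ.* suc d))
                        (cong₂ ℤ._+_ (ℤ.pos-* 1 (suc d)) (ℤ.pos-* a (suc d)))))))

  sumRecip-≥ : ∀ a l d → a ℕ.+ l ℕ.≤ suc d → + l / suc d ℚ.≤ sumRecip a l
  sumRecip-≥ a zero    d le = ℚ.≤-reflexive (ℚ.0/n≡0 (suc d))
  sumRecip-≥ a (suc l) d le rewrite frac-suc l d = ℚ.+-mono-≤
    (frac-≤ 1 d 1 a (ℕ.*-monoʳ-≤ 1 (ℕ.≤-trans (s≤s (ℕ.m≤m+n a l)) le′)))
    (sumRecip-≥ (suc a) l d le′)
    where
    le′ : suc a ℕ.+ l ℕ.≤ suc d
    le′ = subst (ℕ._≤ suc d) (ℕ.+-suc a l) le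

  sumRecip-≤ : ∀ a l d → d ℕ.≤ a → sumRecip a l ℚ.≤ + l / suc d
  sumRecip-≤ a zero    d le = ℚ.≤-reflexive (sym (ℚ.0/n≡0 (suc d)))
  sumRecip-≤ a (suc l) d le rewrite frac-suc l d = ℚ.+-mono-≤
    (frac-≤ 1 a 1 d (ℕ.*-monoʳ-≤ 1 (s≤s le)))
    (sumRecip-≤ (suc a) l d (ℕ.m≤n⇒m≤1+n le))

  sumRecip-+ : ∀ a l m → sumRecip a (l ℕ.+ m) ≡ sumRecip a l ℚ.+ sumRecip (a ℕ.+ l) m
  sumRecip-+ a zero    m rewrite ℕ.+-identityʳ a = sym (ℚ.+-identityˡ (sumRecip a m))
  sumRecip-+ a (suc l) m rewrite sumRecip-+ (suc a) l m | ℕ.+-suc a l =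
    sym (ℚ.+-assoc (+ 1 / suc a) (sumRecip (suc a) l) (sumRecip (suc (a ℕ.+ l)) m))

  -- lnSeq n increases and lnSeq n + 1/(k+1) decreases.
  module LnCauchy (p : ℕ) where
    x : ℕ → ℚ
    x = lnSeq (suc p)

    u : ℕ → ℚ
    u k = + 1 / suc k

    tail : ℕ → ℚ
    tail k = sumRecip (suc k ℕ.+ p ℕ.* suc k) (suc p)

    recurrence : ∀ k → x k ℚ.+ tail k ≡ u (suc k) ℚ.+ x (suc k)
    recurrence k = trans (sym (sumRecip-+ (suc k) (p ℕ.* suc k) (suc p)))
      (cong (sumRecip (suc k)) (solve 2 (λ p M →
        p :* M :+ (con 1 :+ p) := con 1 :+ p :* (con 1 :+ M)) refl p (suc k)))
      where open ℕ.+-*-Solver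

    tail-≥ : ∀ k → u (suc k) ℚ.≤ tail k
    tail-≥ k = ℚ.≤-trans
      (frac-≤ 1 (suc k) (suc p) d (ℕ.≤-reflexive (ℕ.*-identityˡ (suc p ℕ.* suc (suc k)))))
      (sumRecip-≥ (suc k ℕ.+ p ℕ.* suc k) (suc p) d
        (ℕ.≤-reflexive (solve 2 (λ p M →
          M :+ p :* M :+ (con 1 :+ p) := (con 1 :+ p) :* (con 1 :+ M)) refl p (suc k))))
      where
      open ℕ.+-*-Solver
      d = suc k ℕ.+ p ℕ.* suc (suc k)

    tail-≤ : ∀ k → tail k ℚ.≤ u k
    tail-≤ k = ℚ.≤-trans
      (sumRecip-≤ (suc k ℕ.+ p ℕ.* suc k) (suc p) _ ℕ.≤-refl)
      (frac-≤ (suc p) (suc k ℕ.+ p ℕ.* suc k) 1 k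
        (ℕ.≤-trans (ℕ.n≤1+n (suc p ℕ.* suc k))
          (ℕ.≤-reflexive (sym (ℕ.*-identityˡ (suc (suc p ℕ.* suc k)))))))

    x-step : ∀ k → x k ℚ.≤ x (suc k)
    x-step k = +-cancelˡ-≤ (u (suc k)) (begin
      u (suc k) ℚ.+ x k       ≤⟨ ℚ.+-monoˡ-≤ (x k) (tail-≥ k) ⟩
      tail k ℚ.+ x k          ≡⟨ ℚ.+-comm (tail k) (x k) ⟩
      x k ℚ.+ tail k          ≡⟨ recurrence k ⟩
      u (suc k) ℚ.+ x (suc k) ∎)
      where
      open ℚ.≤-Reasoning
      cancel : ∀ r q → ℚ.- r ℚ.+ (r ℚ.+ q) ≡ q
      cancel = solve 2 (λ r q → :- r :+ (r :+ q) := q) refl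
        where open ℚ.+-*-Solver
      +-cancelˡ-≤ : ∀ r {q t} → r ℚ.+ q ℚ.≤ r ℚ.+ t → q ℚ.≤ t
      +-cancelˡ-≤ r {q} {t} le =
        subst₂ ℚ._≤_ (cancel r q) (cancel r t) (ℚ.+-monoʳ-≤ (ℚ.- r) le)

    xu-step : ∀ k → x (suc k) ℚ.+ u (suc k) ℚ.≤ x k ℚ.+ u k
    xu-step k = begin
      x (suc k) ℚ.+ u (suc k) ≡⟨ ℚ.+-comm (x (suc k)) (u (suc k)) ⟩
      u (suc k) ℚ.+ x (suc k) ≡⟨ sym (recurrence k) ⟩
      x k ℚ.+ tail k          ≤⟨ ℚ.+-monoʳ-≤ (x k) (tail-≤ k) ⟩
      x k ℚ.+ u k             ∎
      where open ℚ.≤-Reasoning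

    x-mono : ∀ {N k} → N ℕ.≤′ k → x N ℚ.≤ x k
    x-mono ℕ.≤′-refl       = ℚ.≤-refl
    x-mono (ℕ.≤′-step N≤k) = ℚ.≤-trans (x-mono N≤k) (x-step _)

    xu-mono : ∀ {N k} → N ℕ.≤′ k → x k ℚ.+ u k ℚ.≤ x N ℚ.+ u N
    xu-mono ℕ.≤′-refl       = ℚ.≤-refl
    xu-mono (ℕ.≤′-step N≤k) = ℚ.≤-trans (xu-step _) (xu-mono N≤k)

    x-upper : ∀ {N k} → N ℕ.≤ k → x k ℚ.≤ x N ℚ.+ u N
    x-upper {N} {k} N≤k = ℚ.≤-trans
      (subst (ℚ._≤ x k ℚ.+ u k) (ℚ.+-identityʳ (x k))
        (ℚ.+-monoʳ-≤ (x k) (frac-≤ 0 0 1 k z≤n)))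
      (xu-mono (ℕ.≤⇒≤′ N≤k))

    gap : ∀ {N i j} → N ℕ.≤ i → N ℕ.≤ j → x i ℚ.- x j ℚ.≤ u N
    gap {N} {i} {j} Ni Nj = subst (x i ℚ.- x j ℚ.≤_) (cancel (x N) (u N))
      (ℚ.+-mono-≤ (x-upper Ni) (ℚ.neg-antimono-≤ (x-mono (ℕ.≤⇒≤′ Nj))))
      where
      cancel : ∀ a b → (a ℚ.+ b) ℚ.- a ≡ b
      cancel = solve 2 (λ a b → (a :+ b) :- a := b) refl
        where open ℚ.+-*-Solver

    flip-- : ∀ a b → ℚ.- (a ℚ.- b) ≡ b ℚ.- a
    flip-- = solve 2 (λ a b → :- (a :- b) := b :- a) refl
      where open ℚ.+-*-Solver

    ∣gap∣ : ∀ {N i j} → N ℕ.≤ i → N ℕ.≤ j → ∣ x i ℚ.- x j ∣ ℚ.≤ u N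
    ∣gap∣ {N} {i} {j} Ni Nj with ℚ.∣p∣≡p∨∣p∣≡-p (x i ℚ.- x j)
    ... | inj₁ eq = subst (ℚ._≤ u N) (sym eq) (gap Ni Nj)
    ... | inj₂ eq = subst (ℚ._≤ u N) (sym (trans eq (flip-- (x i) (x j)))) (gap Nj Ni)

    archimedean : ∀ ε → 0ℚ ℚ.< ε → ∃[ N ] u N ℚ.< ε
    archimedean ε@(mkℚ +[1+ a ] d _) _ = suc d , ℚ.toℚᵘ-cancel-<
      (ℚᵘ.<-respˡ-≃ (ℚᵘ.≃-sym (toℚᵘ-frac 1 (suc d)))
        (ℚᵘ.*<* (subst₂ ℤ._<_ (ℤ.pos-* 1 (suc d)) (ℤ.pos-* (suc a) (suc (suc d)))
          (ℤ.+<+ (ℕ.<-≤-trans (subst (ℕ._< suc (suc d)) (sym (ℕ.*-identityˡ (suc d))) ℕ.≤-refl)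
                              (ℕ.m≤m+n (suc (suc d)) (a ℕ.* suc (suc d))))))))
    archimedean (mkℚ (+ 0) _ _)    (ℚ.*<* (ℤ.+<+ ()))
    archimedean (mkℚ -[1+ _ ] _ _) (ℚ.*<* ())

    x-cauchy : IsCauchy x
    x-cauchy ε ε>0 with archimedean ε ε>0
    ... | N , u<ε = N , λ i j Ni Nj → ℚ.≤-<-trans (∣gap∣ Ni Nj) u<ε

  lnSeq-cauchy : ∀ n → .{{ℕ.NonZero n}} → IsCauchy (lnSeq n)
  lnSeq-cauchy (suc p) = LnCauchy.x-cauchy p

ln : (n : ℕ) → .{{ℕ.NonZero n}} → ℝ
ln n = mkℝ (lnSeq n) (lnSeq-cauchy n)

private
  *-positive : ∀ {x y} → Positiveᴿ x → Positiveᴿ y → Positiveᴿ (x *ᴿ y)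
  *-positive {x} (mkPositive b b>0 b≤) (mkPositive c c>0 c≤) = mkPositive (b ℚ.* c)
    (ℚ.positive⁻¹ (b ℚ.* c)
      {{ℚ.pos*pos⇒pos b {{ℚ.positive b>0}} c {{ℚ.positive c>0}}}})
    (λ k → *-mono-≤⁺ (ℚ.<⇒≤ b>0) (ℚ.≤-trans (ℚ.<⇒≤ c>0) (c≤ k)) (b≤ k) (c≤ k))

  ln3-positive : Positiveᴿ (ln 3)
  ln3-positive = mkPositive (+ 2 / 3) (ℚ.positive⁻¹ (+ 2 / 3)) λ k →
    ℚ.≤-trans
      (frac-≤ 2 2 (2 ℕ.* suc k) (k ℕ.+ 2 ℕ.* suc k)
        (ℕ.≤-reflexive (solve 1 (λ M →
          con 2 :* (M :+ con 2 :* M) := (con 2 :* M) :* con 3) refl (suc k))))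
      (sumRecip-≥ (suc k) (2 ℕ.* suc k) (k ℕ.+ 2 ℕ.* suc k) ℕ.≤-refl)
    where open ℕ.+-*-Solver

instance
  6ln3-positive : Positiveᴿ (fromℕᴿ 6 *ᴿ ln 3)
  6ln3-positive = *-positive {fromℕᴿ 6} {ln 3}
    (mkPositive (+ 6 / 1) (ℚ.positive⁻¹ (+ 6 / 1)) (λ _ → ℚ.≤-refl)) ln3-positive

{-# OPTIONS --safe #-}
module Submission where

-- Remove a vertex x from a tree and lay out the remaining components on a segment that extends
-- l places to the left and r places to the right of a marked point. A suitable x makes only one
-- part straddle the point, and this part extends l′ and r′ places with 2l′ + r′ ≤ l and
-- l′ + 2r′ ≤ r; after two such steps l″ ≤ l/5 and r″ ≤ r/5. Hence, if the midpoint of a line of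
-- m places holds a stack of vertices that are adjacent to everything within distance
-- m/2, m/4, m/10, m/20, … of it, these vertices can play the role of x until nothing straddles the
-- midpoint, and the two halves of the line are treated recursively. The stack has about
-- m (1 + 1/2 + 1/5 + 1/10 + …) = 15m/8 edges, so that 15/8 n log₂ n + O(n) edges suffice, up to
-- the sizes of the stacks themselves, which are logarithmic. Finally 15/8 < 95/48 = 19/6 · 5/8,
-- and 5/8 log₂ n ≤ log₃ n because 3⁵ ≤ 2⁸.

open import Defs
open import Data.Nat
open import Data.Nat.Properties
open import Data.Product using (Σ-syntax)

open Graph using (adj; Adj)
import Algebra.Solver.CommutativeMonoid as CommutativeMonoidSolver
open import Data.Bool using (T)
open import Data.Bool.Properties using (T?)
open import Data.Empty using (⊥-elim)
open import Data.Fin as Fin using (Fin; inject₁; fromℕ)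
import Data.Fin.Properties as Fin
import Data.Integer as ℤ
import Data.Integer.Properties as ℤ
open import Data.List using (List; []; _∷_; _++_; map; length; concat; filter; take; drop; allFin; cartesianProduct)
open import Data.List.Properties
open import Data.List.Membership.Propositional
open import Data.List.Membership.Propositional.Properties
open import Data.List.Relation.Binary.Permutation.Propositional using (_↭_; ↭-sym; ↭-trans; ↭-reflexive; ↭-refl; prep; module PermutationReasoning)
import Data.List.Relation.Binary.Permutation.Propositional as ↭
open import Data.List.Relation.Binary.Permutation.Propositional.Properties using (∈-resp-↭; ↭-length; shift; shifts; ++-commutativeMonoid)
import Data.List.Relation.Binary.Permutation.Propositional.Properties as ↭
import Data.List.Relation.Binary.Permutation.Setoid.Properties as ↭ₛ
open import Data.List.Relation.Binary.Sublist.Propositional using (_⊆_; ⊆-reflexive; ⊆-refl; ⊆-trans; minimum; _∷ʳ_)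
import Data.List.Relation.Binary.Sublist.Propositional.Properties as ⊆
open import Data.List.Relation.Unary.All as All using (All; []; _∷_)
import Data.List.Relation.Unary.All.Properties as All
open import Data.List.Relation.Unary.AllPairs using (AllPairs; []; _∷_)
import Data.List.Relation.Unary.AllPairs.Properties as AllPairs
open import Data.List.Relation.Unary.Any using (here; there; any?)
open import Data.List.Relation.Unary.Linked using (Linked; []; [-]; _∷_)
open import Data.List.Relation.Unary.Unique.Propositional using (Unique)
import Data.List.Relation.Unary.Unique.Propositional.Properties as Unique
import Data.Nat as ℕ
import Data.Nat.Properties as ℕ
import Data.Nat.Solver as ℕ
open import Data.Nat.DivMod using (_/_; /-monoˡ-≤; /-monoʳ-≤; m*n/n≡m; m/n*n≤m; m/n≤m; m<n*o⇒m/o<n)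
open import Data.Product using (∃₂; ∃-syntax; _×_; _,_; proj₁; proj₂; uncurry)
import Data.Product.Properties as Product
open import Data.Rational as ℚ using (ℚ)
import Data.Rational.Properties as ℚ
import Data.Rational.Solver as ℚ
import Data.Rational.Unnormalised as ℚᵘ
import Data.Rational.Unnormalised.Properties as ℚᵘ
open import Data.Sum using (_⊎_; inj₁; inj₂)
open import Function using (_∘_; id)
open import Function.Bundles using (mk⇔)
open import Function.Definitions using (Injective)
open import Relation.Binary.Definitions using (DecidableEquality; Symmetric)
open import Relation.Binary.PropositionalEquality
open import Relation.Nullary
open import Relation.Nullary.Decidable using (¬?; _×-dec_; _⊎-dec_; ⌊_⌋; decidable-stable; does-⇔; dec-false; isYes≗does; toWitness; fromWitness)

-- Separators of acyclic graphs

-- A cut may fall inside a stack whose first vertices are already used up, so the lines on either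
-- side inherit unpredictable remnants of it. The statement proved by induction therefore concerns
-- every contiguous interval of a line flanked by arbitrary sublists of its two end stacks. Coverage
-- must not depend on these sublists: a reach either takes in an end stack entirely or stays clear
-- of it, so a line must not be short compared with its end stacks. Lines that are too short become
-- cliques. The gap between 15/8 = 90/48 and 95/48 is the budget for everything else: on a line of m
-- vertices, 5m/48 spare edges pay for the stars inside the stack, for the reach into the end stacks
-- and for a potential charged to the new stack. As stacks have logarithmic size, only lines bounded
-- in terms of their end stacks exceed the budget.

Unique-resp-↭ : {A : Set} {xs ys : List A} → xs ↭ ys → Unique xs → Unique ys
Unique-resp-↭ xs↭ys = ↭ₛ.Unique-resp-↭ (setoid _) (↭.↭⇒↭ₛ xs↭ys)

module Separation
  {A : Set} (_≟ᴬ_ : DecidableEquality A)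
  (_~_ : A → A → Set) (~-sym : Symmetric _~_)
  where

  AtMostOneNeighbour : A → List A → Set
  AtMostOneNeighbour v vs = ∃[ p ] (∀ {w} → w ∈ vs → v ~ w → w ≡ p)

  HasLeaf : List A → Set
  HasLeaf g = ∃[ v ] v ∈ g × AtMostOneNeighbour v g

  -- A hereditary form of acyclicity: it applies directly to the forests left after deleting
  -- vertices, with no induced subgraph to construct.
  Acyclic : Set
  Acyclic = ∀ g → Unique g → g ≢ [] → HasLeaf g

  infix 4 _∥_
  _∥_ : List A → List A → Set
  X ∥ Y = ∀ {u v} → u ∈ X → v ∈ Y → ¬ (u ~ v)

  ∥-sym : Symmetric _∥_
  ∥-sym X∥Y u∈Y v∈X u~v = X∥Y v∈X u∈Y (~-sym u~v)

  []∥ : ∀ {X} → [] ∥ X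
  []∥ ()

  ++-∥ : ∀ {X Y Z} → X ∥ Z → Y ∥ Z → X ++ Y ∥ Z
  ++-∥ {X} X∥Z Y∥Z u∈ with ∈-++⁻ X u∈
  ... | inj₁ u∈X = X∥Z u∈X
  ... | inj₂ u∈Y = Y∥Z u∈Y

  ∥-++ : ∀ {X Y Z} → X ∥ Y → X ∥ Z → X ∥ Y ++ Z
  ∥-++ X∥Y X∥Z = ∥-sym (++-∥ (∥-sym X∥Y) (∥-sym X∥Z))

  concat-∥ : ∀ {Z} {Xs} → All (_∥ Z) Xs → concat Xs ∥ Z
  concat-∥ []            = []∥
  concat-∥ (X∥Z ∷ Xs∥Z) = ++-∥ X∥Z (concat-∥ Xs∥Z)

  -- An elimination ordering: every vertex has at most one neighbour among its successors.
  data Peeling : List A → Set where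
    []  : Peeling []
    _∷_ : ∀ {v vs} → v ∉ vs × AtMostOneNeighbour v vs → Peeling vs → Peeling (v ∷ vs)

  peel : Acyclic → ∀ n g → length g ≡ n → Unique g → ∃[ vs ] vs ↭ g × Peeling vs
  peel acyclic zero    []      _   _  = [] , ↭-refl , []
  peel acyclic (suc n) g@(_ ∷ _) |g| ug with acyclic g ug (λ ())
  ... | v , v∈g , p , nbr with ∈-∃++ v∈g
  ... | ys , zs , g≡ with shift v ys zs | Unique-resp-↭ (↭-trans (↭-reflexive g≡) (shift v ys zs)) ug
  ... | g↭ | uvg′@(_ ∷ ug′) with ↭-trans (↭-reflexive g≡) g↭
  ... | σ with peel acyclic n (ys ++ zs) (suc-injective (trans (sym (↭-length σ)) |g|)) ug′
  ... | vs , vs↭ , P = v ∷ vs , ↭-trans (prep v vs↭) (↭-sym σ)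
      , ((λ v∈vs → Unique.Unique[x∷xs]⇒x∉xs uvg′ (∈-resp-↭ vs↭ v∈vs))
        , p , λ w∈vs → nbr (∈-resp-↭ (↭-sym σ) (there (∈-resp-↭ vs↭ w∈vs)))) ∷ P

  -- `small` makes each part a movable block for the packing. `enough` makes the parts fill the left
  -- side when `rest` is cut off whole; `rest ≡ []` arises when the peeling ends before any vertex
  -- gathers `l` vertices.
  record Separator (l : ℕ) (g : List A) : Set where
    field
      x         : A
      parts     : List (List A)
      rest      : List A
      perm      : g ↭ x ∷ concat parts ++ rest
      small     : All (λ K → length K ≤ l) parts
      separated : AllPairs _∥_ parts
      parts∥    : All (_∥ rest) parts
      enough    : rest ≡ [] ⊎ l ≤ length (concat parts)

  Cluster : Set
  Cluster = List A × A

  members : List Cluster → List A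
  members Cs = concat (map proj₁ Cs)

  AttachedAt : A → Cluster → Set
  AttachedAt v C = proj₂ C ≡ v

  attachedAt? : ∀ v (C : Cluster) → Dec (AttachedAt v C)
  attachedAt? v C = proj₂ C ≟ᴬ v

  Attached : List A → Cluster → Set
  Attached vs (C , p) = ∀ {u w} → u ∈ C → w ∈ vs → u ~ w → w ≡ p

  members-filter : ∀ v Cs →
    members Cs ↭ members (filter (attachedAt? v) Cs) ++ members (filter (¬? ∘ attachedAt? v) Cs)
  members-filter v [] = ↭-refl
  members-filter v ((C , p) ∷ Cs) with p ≟ᴬ v
  ... | yes _ = ↭-trans (↭.++⁺ˡ C (members-filter v Cs)) (↭-reflexive (sym (++-assoc C _ _)))
  ... | no  _ = ↭-trans (↭.++⁺ˡ C (members-filter v Cs)) (shifts C (members (filter (attachedAt? v) Cs)))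

  filter-∥ : ∀ v Cs → AllPairs (λ C D → proj₁ C ∥ proj₁ D) Cs →
    members (filter (attachedAt? v) Cs) ∥ members (filter (¬? ∘ attachedAt? v) Cs)
  filter-∥ v [] _ = []∥
  filter-∥ v ((C , p) ∷ Cs) (C∥Cs ∷ ∥Cs) with p ≟ᴬ v
  ... | yes _ = ++-∥ (∥-sym (concat-∥ (All.map⁺ (All.map ∥-sym (All.filter⁺ (¬? ∘ attachedAt? v) C∥Cs)))))
                     (filter-∥ v Cs ∥Cs)
  ... | no  _ = ∥-++ (concat-∥ (All.map⁺ (All.map ∥-sym (All.filter⁺ (attachedAt? v) C∥Cs))))
                     (filter-∥ v Cs ∥Cs)

  -- The clusters are the components spanned by the vertices already peeled; each is
  -- attached to at most one remaining vertex. The separator is the first vertex whose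
  -- attached clusters have l vertices in total.
  separator′ : ∀ l v vs Cs → Peeling (v ∷ vs) →
    All (λ C → length (proj₁ C) ≤ l) Cs →
    AllPairs (λ C D → proj₁ C ∥ proj₁ D) Cs →
    All (Attached (v ∷ vs)) Cs →
    Separator l (members Cs ++ v ∷ vs)
  separator′ l v vs Cs ((v∉vs , p , nbr) ∷ P) small ∥Cs att = choose (l ≤? length K) vs refl
    where
    at    = attachedAt? v
    Ks    = filter at Cs
    Os    = filter (¬? ∘ at) Cs
    K     = members Ks
    O     = members Os

    K-small = All.map⁺ (All.filter⁺ at small)
    K-∥     = AllPairs.map⁺ (AllPairs.filter⁺ at ∥Cs)

    Ks∥vs : ∀ {C} → AttachedAt v C → Attached (v ∷ vs) C → proj₁ C ∥ vs
    Ks∥vs refl at-v u∈C w∈vs u~w with at-v u∈C (there w∈vs) u~w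
    ... | refl = v∉vs w∈vs

    K∥vs : All (λ C → proj₁ C ∥ vs) Ks
    K∥vs = All.zipWith (λ {C} → uncurry (Ks∥vs {C})) (All.all-filter at Cs , All.filter⁺ at att)

    v∥O : ∀ {C} → ¬ AttachedAt v C → Attached (v ∷ vs) C → proj₁ C ∥ (v ∷ [])
    v∥O p≢v at-p u∈C (here refl) u~v = p≢v (sym (at-p u∈C (here refl) u~v))

    O∥v : O ∥ (v ∷ [])
    O∥v = concat-∥ (All.map⁺ (All.zipWith (λ {C} → uncurry (v∥O {C}))
                     (All.all-filter (¬? ∘ at) Cs , All.filter⁺ (¬? ∘ at) att)))

    each : ∀ {Xs Y} → concat Xs ∥ Y → All (_∥ Y) Xs
    each {[]}     _   = []
    each {X ∷ Xs} X∥Y = (λ u∈X → X∥Y (∈-++⁺ˡ u∈X)) ∷ each (λ u∈Xs → X∥Y (∈-++⁺ʳ X u∈Xs))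


    choose : Dec (l ≤ length K) → ∀ us → us ≡ vs → Separator l (members Cs ++ v ∷ vs)
    choose (yes l≤K) _ _ = record
      { x = v ; parts = map proj₁ Ks ; rest = O ++ vs
      ; perm = begin
          members Cs ++ v ∷ vs   ↭⟨ ↭.++⁺ʳ (v ∷ vs) (members-filter v Cs) ⟩
          (K ++ O) ++ v ∷ vs     ↭⟨ shift v (K ++ O) vs ⟩
          v ∷ (K ++ O) ++ vs     ≡⟨ cong (v ∷_) (++-assoc K O vs) ⟩
          v ∷ K ++ O ++ vs       ∎
      ; small = K-small ; separated = K-∥
      ; parts∥ = each (∥-++ (filter-∥ v Cs ∥Cs) (concat-∥ (All.map⁺ K∥vs)))
      ; enough = inj₂ l≤K }
      where open PermutationReasoning
    -- `v` is the last vertex, so nothing else ties the clusters together: all become parts,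
    -- attached at `v` or not.
    choose (no _) [] refl = record
      { x = v ; parts = map proj₁ Cs ; rest = []
      ; perm = ↭-trans (shift v (members Cs) []) (prep v ↭-refl)
      ; small = All.map⁺ small ; separated = AllPairs.map⁺ ∥Cs
      ; parts∥ = All.universal (λ _ {_} {_} _ ()) _ ; enough = inj₁ refl }
    -- `v` and the clusters attached at it merge into one. Its only later neighbour is that of `v`,
    -- and since `K` has fewer than `l` members, adding `v` keeps the size at most `l`.
    choose (no l≰K) (v′ ∷ vs′) refl = record
      { x = S.x ; parts = S.parts ; rest = S.rest
      ; perm = ↭-trans regroup S.perm
      ; small = S.small ; separated = S.separated ; parts∥ = S.parts∥ ; enough = S.enough }
      where
      C∥O : v ∷ K ∥ O
      C∥O = ++-∥ {v ∷ []} (∥-sym O∥v) (filter-∥ v Cs ∥Cs)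
      att-C : Attached (v′ ∷ vs′) (v ∷ K , p)
      att-C (here refl) w∈ u~w = nbr w∈ u~w
      att-C (there u∈K) w∈ u~w = ⊥-elim (concat-∥ (All.map⁺ K∥vs) u∈K w∈ u~w)
      module S = Separator (separator′ l v′ vs′ ((v ∷ K , p) ∷ Os) P
        (≰⇒> l≰K ∷ All.filter⁺ (¬? ∘ at) small)
        (All.map ∥-sym (All.map⁻ (each (∥-sym C∥O))) ∷ AllPairs.filter⁺ (¬? ∘ at) ∥Cs)
        (att-C ∷ All.map (λ at-p {_} {_} u∈ w∈ → at-p u∈ (there w∈)) (All.filter⁺ (¬? ∘ at) att)))
      regroup : members Cs ++ v ∷ vs ↭ ((v ∷ K) ++ O) ++ v′ ∷ vs′
      regroup = ↭-trans (↭.++⁺ʳ (v ∷ vs) (members-filter v Cs)) (shift v (K ++ O) vs)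

  separator : Acyclic → ∀ l g → Unique g → g ≢ [] → Separator l g
  separator acyclic l g ug g≢[] with peel acyclic (length g) g refl ug
  ... | [] , σ , _ = ⊥-elim (g≢[] (↭.↭-empty-inv (↭-sym σ)))
  ... | v ∷ vs , σ , P = record
    { x = S.x ; parts = S.parts ; rest = S.rest ; perm = ↭-trans (↭-sym σ) S.perm
    ; small = S.small ; separated = S.separated ; parts∥ = S.parts∥ ; enough = S.enough }
    where module S = Separator (separator′ l v vs [] P [] [] [])

  -- How an acyclic graph on l + 1 + b + r vertices comes apart when x is removed and the
  -- remaining vertices are laid out on a segment of l, b and r places: either the cut falls
  -- into the b middle places, or a part X straddles them.
  data Split (l b r : ℕ) (g : List A) : Set where
    two : ∀ x L R i j →
      g ↭ x ∷ L ++ R → L ∥ R →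
      length L ≡ l + i → length R ≡ j + r → i + j ≡ b → Split l b r g
    three : ∀ x L X R l₁ l₂ r₁ r₂ →
      g ↭ x ∷ L ++ X ++ R → L ∥ X → L ∥ R → X ∥ R →
      l ≡ l₁ + l₂ → r ≡ r₁ + r₂ →
      length L ≡ l₁ → length X ≡ l₂ + (b + r₁) → length R ≡ r₂ →
      l₂ + r₁ ≤ l₁ → l₂ + r₁ ≤ r₂ → Split l b r g

  -- Packing the parts at a separator into a segment

  All-∥-++ : ∀ {X Y Zs} → All (_∥ X) Zs → All (Y ∥_) Zs → All (_∥ X ++ Y) Zs
  All-∥-++ []            []            = []
  All-∥-++ (Z∥X ∷ Zs∥X) (Y∥Z ∷ Y∥Zs) = ∥-++ Z∥X (∥-sym Y∥Z) ∷ All-∥-++ Zs∥X Y∥Zs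

  module _ where
    open CommutativeMonoidSolver (++-commutativeMonoid {A = A})

    Split-sym : ∀ {l b r g} → Split r b l g → Split l b r g
    Split-sym {l} {r = r} (two x L R i j σ L∥R |L| |R| i+j) = two x R L j i
      (↭-trans σ (prep x (↭.++-comm L R))) (∥-sym L∥R)
      (trans |R| (+-comm j l)) (trans |L| (+-comm r i)) (trans (+-comm j i) i+j)
    Split-sym {b = b} (three x L X R l₁ l₂ r₁ r₂ σ L∥X L∥R X∥R l≡ r≡ |L| |X| |R| ≤l₁ ≤r₂) =
      three x R X L r₂ r₁ l₂ l₁
        (↭-trans σ (prep x (solve 3 (λ L X R → L ⊕ X ⊕ R ⊜ R ⊕ X ⊕ L) ↭-refl L X R)))
        (∥-sym X∥R) (∥-sym L∥R) (∥-sym L∥X)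
        (trans r≡ (+-comm r₁ r₂)) (trans l≡ (+-comm l₁ l₂)) |R|
        (trans |X| (ℕ.+-*-Solver.solve 3 (λ l b r →
           l ℕ.+-*-Solver.:+ (b ℕ.+-*-Solver.:+ r) ℕ.+-*-Solver.:=
           r ℕ.+-*-Solver.:+ (b ℕ.+-*-Solver.:+ l)) refl l₂ b r₁)) |L|
        (subst (_≤ r₂) (+-comm l₂ r₁) ≤r₂) (subst (_≤ l₁) (+-comm l₂ r₁) ≤l₁)

    -- The smallest piece goes to the middle. If it takes `l₂` and `r₁` places beside the `b` middle
    -- ones, then `l₂ + r₁` is at most its size, hence at most `l₁` and `r₂`; this gives 2l₂ + r₁ ≤
    -- l and l₂ + 2r₁ ≤ r. The bounds `length X ≤ l ≤ r` allow `X` to take either side.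
    smallest-middle : ∀ {l b r g x L X R} → l ≤ r →
      g ↭ x ∷ L ++ X ++ R → L ∥ X → L ∥ R → X ∥ R →
      length L ≤ l → length X ≤ l → length R ≤ r →
      length L + (length X + length R) ≡ l + (b + r) → Split l b r g
    smallest-middle {l} {b} {r} {g} {x} {L} {X} {R} l≤r σ L∥X L∥R X∥R |L| |X| |R| sum =
      order (≤-total (length X) (length L)) (≤-total (length X) (length R)) (≤-total (length L) (length R))
      where
      done : ∀ L X R → g ↭ x ∷ L ++ X ++ R → L ∥ X → L ∥ R → X ∥ R →
        length L ≤ l → length R ≤ r → length L + (length X + length R) ≡ l + (b + r) →
        length X ≤ length L → length X ≤ length R → Split l b r g
      done L X R σ L∥X L∥R X∥R |L| |R| sum X≤L X≤R =
        three x L X R (length L) l₂ r₁ (length R) σ L∥X L∥R X∥R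
          (sym (m+[n∸m]≡n |L|)) (sym (m∸n+n≡m |R|)) refl X≡ refl
          (≤-trans l₂+r₁≤X X≤L) (≤-trans l₂+r₁≤X X≤R)
        where
        l₂ = l ∸ length L
        r₁ = r ∸ length R
        open ℕ.+-*-Solver renaming (solve to solveℕ)
        X≡ : length X ≡ l₂ + (b + r₁)
        X≡ = +-cancelˡ-≡ (length L + length R) _ _ (begin
          length L + length R + length X          ≡⟨ solveℕ 3 (λ L X R → L :+ R :+ X := L :+ (X :+ R)) refl (length L) (length X) (length R) ⟩
          length L + (length X + length R)        ≡⟨ sum ⟩
          l + (b + r)                             ≡⟨ cong₂ (λ l r → l + (b + r)) (sym (m+[n∸m]≡n |L|)) (sym (m∸n+n≡m |R|)) ⟩
          length L + l₂ + (b + (r₁ + length R))   ≡⟨ solveℕ 5 (λ L l₂ b r₁ R → L :+ l₂ :+ (b :+ (r₁ :+ R)) := L :+ R :+ (l₂ :+ (b :+ r₁))) refl (length L) l₂ b r₁ (length R) ⟩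
          length L + length R + (l₂ + (b + r₁))   ∎)
          where open ≡-Reasoning
        l₂+r₁≤X : l₂ + r₁ ≤ length X
        l₂+r₁≤X = subst (l₂ + r₁ ≤_) (sym X≡) (+-monoʳ-≤ l₂ (m≤n+m r₁ b))

      swap-LX = done X L R (↭-trans σ (prep x (shifts L X))) (∥-sym L∥X) X∥R L∥R |X| |R|
        (trans (x+[y+z]≡y+[x+z] (length X) (length L) (length R)) sum)
        where
        x+[y+z]≡y+[x+z] : ∀ a b c → a + (b + c) ≡ b + (a + c)
        x+[y+z]≡y+[x+z] = solveℕ 3 (λ a b c → a :+ (b :+ c) := b :+ (a :+ c)) refl
          where open ℕ.+-*-Solver renaming (solve to solveℕ)
      swap-XR = done L R X (↭-trans σ (prep x (↭.++⁺ˡ L (↭.++-comm X R)))) L∥R L∥X (∥-sym X∥R)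
        |L| (≤-trans |X| l≤r)
        (trans (cong (length L +_) (+-comm (length R) (length X))) sum)

      order : length X ≤ length L ⊎ length L ≤ length X →
              length X ≤ length R ⊎ length R ≤ length X →
              length L ≤ length R ⊎ length R ≤ length L → Split l b r g
      order (inj₁ X≤L) (inj₁ X≤R) _          = done L X R σ L∥X L∥R X∥R |L| |R| sum X≤L X≤R
      order (inj₁ X≤L) (inj₂ R≤X) _          = swap-XR (≤-trans R≤X X≤L) R≤X
      order (inj₂ L≤X) _          (inj₁ L≤R) = swap-LX L≤X L≤R
      order (inj₂ L≤X) _          (inj₂ R≤L) = swap-XR R≤L (≤-trans R≤L L≤X)

    -- Greedy packing: blocks go left or right while they fit. A block that fits on neither side
    -- either ends within the `b` middle places, which gives a cut, or overshoots them from both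
    -- sides; then all other blocks fit on the right, and `L`, `K` and `C ++ R` are three admissible
    -- pieces.
    distribute : ∀ {l b r g} → l ≤ r → ∀ x L R Ks →
      g ↭ x ∷ L ++ concat Ks ++ R → L ∥ R →
      All (λ K → length K ≤ l) Ks → AllPairs _∥_ Ks → All (_∥ L) Ks → All (_∥ R) Ks →
      length L ≤ l → length R ≤ r →
      length L + (length (concat Ks) + length R) ≡ l + (b + r) → Split l b r g
    -- With no block left, `length L ≤ l` and `length R ≤ r` are forced to be equalities, so the cut
    -- is exact.
    distribute {l} {b} {r} {g} l≤r x L R [] σ L∥R _ _ _ _ |L| |R| sum =
      two x L R 0 b σ L∥R (trans L≡l (sym (+-identityʳ l))) (+-cancelˡ-≡ l _ _ (trans (cong (_+ length R) (sym L≡l)) sum)) refl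
      where
      L≡l : length L ≡ l
      L≡l = ≤-antisym |L| (+-cancelʳ-≤ (b + r) l (length L)
        (subst (_≤ length L + (b + r)) sum (+-monoʳ-≤ (length L) (≤-trans |R| (m≤n+m r b)))))
    distribute {l} {b} {r} {g} l≤r x L R (K ∷ Ks) σ L∥R (|K| ∷ small) (K∥Ks ∷ Ks∥) (K∥L ∷ Ks∥L) (K∥R ∷ Ks∥R) |L| |R| sum =
      try (length L + length K ≤? l) (length R + length K ≤? r) (length L + length K ≤? l + b) (length R + length K ≤? r + b)
      where
      C = concat Ks
      K∥C : K ∥ C
      K∥C = ∥-sym (concat-∥ (All.map ∥-sym K∥Ks))
      L∥C : L ∥ C
      L∥C = ∥-sym (concat-∥ Ks∥L)
      R∥C : R ∥ C
      R∥C = ∥-sym (concat-∥ Ks∥R)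
      total : length L + ((length K + length C) + length R) ≡ l + (b + r)
      total = trans (cong (λ k → length L + (k + length R)) (sym (length-++ K))) sum
      open ℕ.+-*-Solver renaming (solve to solveℕ)
      try : Dec (length L + length K ≤ l) → Dec (length R + length K ≤ r) →
            Dec (length L + length K ≤ l + b) → Dec (length R + length K ≤ r + b) → Split l b r g
      try (yes fits) _ _ _ = distribute l≤r x (L ++ K) R Ks
        (↭-trans σ (prep x (solve 4 (λ L K C R → L ⊕ (K ⊕ C) ⊕ R ⊜ (L ⊕ K) ⊕ C ⊕ R) ↭-refl L K C R)))
        (++-∥ L∥R K∥R) small Ks∥ (All-∥-++ Ks∥L K∥Ks) Ks∥R
        (subst (_≤ l) (sym (length-++ L)) fits) |R|
        (trans (cong (_+ (length C + length R)) (length-++ L))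
          (trans (solveℕ 4 (λ L K C R → L :+ K :+ (C :+ R) := L :+ ((K :+ C) :+ R)) refl (length L) (length K) (length C) (length R)) total))
      try (no _) (yes fits) _ _ = distribute l≤r x L (R ++ K) Ks
        (↭-trans σ (prep x (solve 4 (λ L K C R → L ⊕ (K ⊕ C) ⊕ R ⊜ L ⊕ C ⊕ (R ⊕ K)) ↭-refl L K C R)))
        (∥-++ L∥R (∥-sym K∥L)) small Ks∥ Ks∥L (All-∥-++ Ks∥R K∥Ks)
        |L| (subst (_≤ r) (sym (length-++ R)) fits)
        (trans (cong (λ k → length L + (length C + k)) (length-++ R))
          (trans (solveℕ 4 (λ L K C R → L :+ (C :+ (R :+ K)) := L :+ ((K :+ C) :+ R)) refl (length L) (length K) (length C) (length R)) total))
      try (no over) (no _) (yes fits) _ = two x (L ++ K) (C ++ R) i j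
        (↭-trans σ (prep x (solve 4 (λ L K C R → L ⊕ (K ⊕ C) ⊕ R ⊜ (L ⊕ K) ⊕ (C ⊕ R)) ↭-refl L K C R)))
        (++-∥ (∥-++ L∥C L∥R) (∥-++ K∥C K∥R)) |LK| |CR| (m+[n∸m]≡n i≤b)
        where
        i = length L + length K ∸ l
        j = b ∸ i
        i≤b : i ≤ b
        i≤b = m≤n+o⇒m∸n≤o _ l fits
        LK : length L + length K ≡ l + i
        LK = sym (m+[n∸m]≡n (<⇒≤ (≰⇒> over)))
        |LK| = trans (length-++ L) LK
        |CR| : length (C ++ R) ≡ j + r
        |CR| = +-cancelˡ-≡ (length L + length K) _ _ (begin
          length L + length K + length (C ++ R)         ≡⟨ cong (length L + length K +_) (length-++ C) ⟩
          length L + length K + (length C + length R)   ≡⟨ solveℕ 4 (λ L K C R → L :+ K :+ (C :+ R) := L :+ ((K :+ C) :+ R)) refl (length L) (length K) (length C) (length R) ⟩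
          length L + ((length K + length C) + length R) ≡⟨ total ⟩
          l + (b + r)                                   ≡⟨ cong (λ b → l + (b + r)) (sym (m+[n∸m]≡n i≤b)) ⟩
          l + (i + j + r)                               ≡⟨ solveℕ 4 (λ l i j r → l :+ (i :+ j :+ r) := l :+ i :+ (j :+ r)) refl l i j r ⟩
          l + i + (j + r)                               ≡⟨ cong (_+ (j + r)) (sym LK) ⟩
          length L + length K + (j + r)                 ∎)
          where open ≡-Reasoning
      try (no _) (no over) (no _) (yes fits) = two x (L ++ C) (R ++ K) i j
        (↭-trans σ (prep x (solve 4 (λ L K C R → L ⊕ (K ⊕ C) ⊕ R ⊜ (L ⊕ C) ⊕ (R ⊕ K)) ↭-refl L K C R)))
        (++-∥ (∥-++ L∥R (∥-sym K∥L)) (∥-++ (∥-sym R∥C) (∥-sym K∥C))) |LC| |RK| (m∸n+n≡m j≤b)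
        where
        j = length R + length K ∸ r
        i = b ∸ j
        j≤b : j ≤ b
        j≤b = m≤n+o⇒m∸n≤o _ r fits
        RK : length R + length K ≡ j + r
        RK = sym (m∸n+n≡m (<⇒≤ (≰⇒> over)))
        |RK| = trans (length-++ R) RK
        |LC| : length (L ++ C) ≡ l + i
        |LC| = +-cancelʳ-≡ (length R + length K) _ _ (begin
          length (L ++ C) + (length R + length K)       ≡⟨ cong (_+ (length R + length K)) (length-++ L) ⟩
          length L + length C + (length R + length K)   ≡⟨ solveℕ 4 (λ L K C R → L :+ C :+ (R :+ K) := L :+ ((K :+ C) :+ R)) refl (length L) (length K) (length C) (length R) ⟩
          length L + ((length K + length C) + length R) ≡⟨ total ⟩
          l + (b + r)                                   ≡⟨ cong (λ b → l + (b + r)) (sym (m∸n+n≡m j≤b)) ⟩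
          l + (i + j + r)                               ≡⟨ solveℕ 4 (λ l i j r → l :+ (i :+ j :+ r) := l :+ i :+ (j :+ r)) refl l i j r ⟩
          l + i + (j + r)                               ≡⟨ cong (l + i +_) (sym RK) ⟩
          l + i + (length R + length K)                 ∎)
          where open ≡-Reasoning
      try _ _ (no overL) (no _) = smallest-middle {X = K} {R = C ++ R} l≤r
        (↭-trans σ (prep x (solve 4 (λ L K C R → L ⊕ (K ⊕ C) ⊕ R ⊜ L ⊕ K ⊕ (C ⊕ R)) ↭-refl L K C R)))
        (∥-sym K∥L) (∥-++ L∥C L∥R) (∥-++ K∥C K∥R) |L| |K| CR≤r
        (trans (cong (λ k → length L + (length K + k)) (length-++ C))
          (trans (solveℕ 4 (λ L K C R → L :+ (K :+ (C :+ R)) := L :+ ((K :+ C) :+ R)) refl (length L) (length K) (length C) (length R)) total))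
        where
        CR≤r : length (C ++ R) ≤ r
        CR≤r = subst (_≤ r) (sym (length-++ C)) (+-cancelˡ-≤ (length L + length K) _ _ (begin
          length L + length K + (length C + length R)   ≡⟨ solveℕ 4 (λ L K C R → L :+ K :+ (C :+ R) := L :+ ((K :+ C) :+ R)) refl (length L) (length K) (length C) (length R) ⟩
          length L + ((length K + length C) + length R) ≡⟨ total ⟩
          l + (b + r)                                   ≡⟨ sym (+-assoc l b r) ⟩
          l + b + r                                     ≤⟨ +-monoˡ-≤ r (<⇒≤ (≰⇒> overL)) ⟩
          length L + length K + r                       ∎))
          where open ≤-Reasoning

    -- The threshold is the shorter side `l`, so each part fits into either side when empty. If
    -- `rest` fills the right side, `enough` keeps it within `b + r` places and the cut separates
    -- the parts from it; otherwise `rest` starts the right side and the parts are packed around it.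
    split-≤ : Acyclic → ∀ l b r → l ≤ r → ∀ g → Unique g → length g ≡ suc (l + (b + r)) → Split l b r g
    split-≤ acyclic l b r l≤r g ug |g| = place (r ≤? length rest)
      where
      g≢[] : g ≢ []
      g≢[] refl = 0≢1+n |g|
      open Separator (separator acyclic l g ug g≢[])
      C = concat parts
      total : length C + length rest ≡ l + (b + r)
      total = suc-injective (trans (trans (cong suc (sym (length-++ C))) (sym (↭-length perm))) |g|)
      place : Dec (r ≤ length rest) → Split l b r g
      place (no r≰) = distribute l≤r x [] rest parts perm []∥ small separated
        (All.universal (λ _ {_} {_} _ ()) _) parts∥ z≤n (<⇒≤ (≰⇒> r≰)) total
      place (yes r≤) = two x C rest i j perm (concat-∥ parts∥) |C| (sym (m∸n+n≡m r≤)) (m∸n+n≡m j≤b)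
        where
        j = length rest ∸ r
        i = b ∸ j
        rest≤ : rest ≡ [] ⊎ l ≤ length C → length rest ≤ b + r
        rest≤ (inj₁ rest≡[]) = subst (λ xs → length xs ≤ b + r) (sym rest≡[]) z≤n
        rest≤ (inj₂ l≤C)     = +-cancelˡ-≤ l _ _ (subst (l + length rest ≤_) total (+-monoˡ-≤ (length rest) l≤C))
        j≤b : j ≤ b
        j≤b = m≤n+o⇒m∸n≤o _ r (subst (length rest ≤_) (+-comm b r) (rest≤ enough))
        |C| : length C ≡ l + i
        |C| = +-cancelʳ-≡ (length rest) _ _ (begin
          length C + length rest ≡⟨ total ⟩
          l + (b + r)            ≡⟨ cong (λ b → l + (b + r)) (sym (m∸n+n≡m j≤b)) ⟩
          l + (i + j + r)        ≡⟨ solveℕ 4 (λ l i j r → l :+ (i :+ j :+ r) := l :+ i :+ (j :+ r)) refl l i j r ⟩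
          l + i + (j + r)        ≡⟨ cong (l + i +_) (m∸n+n≡m r≤) ⟩
          l + i + length rest    ∎)
          where
          open ≡-Reasoning
          open ℕ.+-*-Solver renaming (solve to solveℕ)

    split : Acyclic → ∀ l b r g → Unique g → length g ≡ suc (l + (b + r)) → Split l b r g
    split acyclic l b r g ug |g| with ≤-total l r
    ... | inj₁ l≤r = split-≤ acyclic l b r l≤r g ug |g|
    ... | inj₂ r≤l = Split-sym (split-≤ acyclic r b l r≤l g ug
      (trans |g| (cong suc (solveℕ 3 (λ l b r → l :+ (b :+ r) := r :+ (b :+ l)) refl l b r))))
      where open ℕ.+-*-Solver renaming (solve to solveℕ)

-- Hosting acyclic graphs on a hub

Unique-++⁻ : {A : Set} (xs : List A) {ys : List A} → Unique (xs ++ ys) → Unique xs × Unique ys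
Unique-++⁻ []       u        = [] , u
Unique-++⁻ (x ∷ xs) (x∉ ∷ u) =
  let uxs , uys = Unique-++⁻ xs u in All.++⁻ˡ xs x∉ ∷ uxs , uys

++-split : {A : Set} (xs : List A) {ys us vs : List A} → xs ++ ys ≡ us ++ vs →
  (∃[ w ] us ≡ xs ++ w × ys ≡ w ++ vs) ⊎ (∃[ w ] xs ≡ us ++ w × vs ≡ w ++ ys)
++-split []                      eq = inj₁ (_ , refl , eq)
++-split (x ∷ xs) {us = []}      eq = inj₂ (_ , refl , sym eq)
++-split (x ∷ xs) {us = u ∷ us}  eq with ∷-injective eq
... | refl , eq′ with ++-split xs eq′
... | inj₁ (w , us≡ , ys≡) = inj₁ (w , cong (x ∷_) us≡ , ys≡)
... | inj₂ (w , xs≡ , vs≡) = inj₂ (w , cong (x ∷_) xs≡ , vs≡)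

split-at : {A : Set} (xs : List A) (m n : ℕ) → length xs ≡ m + n →
  ∃₂ λ ys zs → xs ≡ ys ++ zs × length ys ≡ m × length zs ≡ n
split-at xs       zero    n |xs| = [] , xs , refl , refl , |xs|
split-at (x ∷ xs) (suc m) n |xs| with split-at xs m n (suc-injective |xs|)
... | ys , zs , xs≡ , |ys| , |zs| = x ∷ ys , zs , cong (x ∷_) xs≡ , cong suc |ys| , |zs|

*≤⇒≤/ : ∀ m n {o} .{{_ : NonZero n}} → m * n ≤ o → m ≤ o / n
*≤⇒≤/ m n le = subst (_≤ _) (m*n/n≡m m n) (/-monoˡ-≤ n le)

module Hubs {V : Set} (Cov : V → V → Set) where

  -- τ covers the last x vertices to the left of the stack and the first y to its right,
  -- no matter which vertices of the neighbouring stacks jl and jr are present.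
  record Reach (jl L R jr : List V) (τ : V) (x y : ℕ) : Set where
    field
      reachˡ : ∀ {jl′} → jl′ ⊆ jl → ∀ w₁ w₂ → w₁ ++ w₂ ≡ jl′ ++ L → length w₂ ≤ x → All (Cov τ) w₂
      reachʳ : ∀ {jr′} → jr′ ⊆ jr → ∀ s₁ s₂ → s₁ ++ s₂ ≡ R ++ jr′ → length s₁ ≤ y → All (Cov τ) s₁

  -- Two steps across a stack shrink the straddling part on both sides by a factor five.
  data Chain (jl L st R jr : List V) : ℕ → ℕ → List V → Set where
    end  : ∀ {y ts} → Chain jl L st R jr 0 y ts
    pair : ∀ {x y τ₁ τ₂ ts} →
      All (Cov τ₁) st → Reach jl L R jr τ₁ x y →
      All (Cov τ₂) st → Reach jl L R jr τ₂ (x / 2) (y / 2) →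
      Chain jl L st R jr (x / 5) (y / 5) ts →
      Chain jl L st R jr x y (τ₁ ∷ τ₂ ∷ ts)

  -- jl and jr are the stacks at the two ends of the line: when a cut falls inside a stack, its
  -- leftover vertices join the lines on either side.
  data Hub : List V → List V → List V → Set where
    leaf : ∀ {jl line jr} →
      (∀ {a b} → a ∈ jl ++ line ++ jr → b ∈ jl ++ line ++ jr → Cov a b) → Hub jl line jr
    node : ∀ {jl L st R jr x y} → length (jl ++ L) ≤ x → length (R ++ jr) ≤ y →
      Chain jl L st R jr x y st → Hub jl L st → Hub st R jr → Hub jl (L ++ st ++ R) jr

-- Placing forests on a hub

module Embedding
  {A V : Set} (_≟ᴬ_ : DecidableEquality A)
  (_~_ : A → A → Set) (~-sym : Symmetric _~_) (~-irrefl : ∀ {u} → ¬ (u ~ u))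
  (acyclic : Separation.Acyclic _≟ᴬ_ _~_ ~-sym)
  (Cov : V → V → Set) (Cov-sym : Symmetric Cov)
  where

  open Separation _≟ᴬ_ _~_ ~-sym
  open Hubs Cov

  -- A bijection kept as a list of pairs whose projections are permutations of `g` and `S`, so that
  -- placements are joined by concatenation and reordered freely.
  record Placement (g : List A) (S : List V) : Set where
    field
      pairs  : List (A × V)
      labels : map proj₁ pairs ↭ g
      places : map proj₂ pairs ↭ S
      covers : ∀ {p q} → p ∈ pairs → q ∈ pairs → proj₁ p ~ proj₁ q → Cov (proj₂ p) (proj₂ q)

  relocate : ∀ {g g′ S S′} → g ↭ g′ → S ↭ S′ → Placement g S → Placement g′ S′
  relocate g↭ S↭ P = record
    { pairs = pairs ; labels = ↭-trans labels g↭ ; places = ↭-trans places S↭ ; covers = covers }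
    where open Placement P

  join : ∀ {g h S T} → g ∥ h → Placement g S → Placement h T → Placement (g ++ h) (S ++ T)
  join {g} {h} g∥h P Q = record
    { pairs  = P.pairs ++ Q.pairs
    ; labels = ↭-trans (↭-reflexive (map-++ proj₁ P.pairs Q.pairs)) (↭.++⁺ P.labels Q.labels)
    ; places = ↭-trans (↭-reflexive (map-++ proj₂ P.pairs Q.pairs)) (↭.++⁺ P.places Q.places)
    ; covers = λ p∈ q∈ → covers (∈-++⁻ P.pairs p∈) (∈-++⁻ P.pairs q∈) }
    where
    module P = Placement P
    module Q = Placement Q
    apart : ∀ {p q} → p ∈ P.pairs → q ∈ Q.pairs → ¬ (proj₁ p ~ proj₁ q)
    apart p∈ q∈ = g∥h (∈-resp-↭ P.labels (∈-map⁺ proj₁ p∈)) (∈-resp-↭ Q.labels (∈-map⁺ proj₁ q∈))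
    covers : ∀ {p q} → p ∈ P.pairs ⊎ p ∈ Q.pairs → q ∈ P.pairs ⊎ q ∈ Q.pairs →
             proj₁ p ~ proj₁ q → Cov (proj₂ p) (proj₂ q)
    covers (inj₁ p∈) (inj₁ q∈) p~q = P.covers p∈ q∈ p~q
    covers (inj₁ p∈) (inj₂ q∈) p~q = ⊥-elim (apart p∈ q∈ p~q)
    covers (inj₂ p∈) (inj₁ q∈) p~q = ⊥-elim (apart q∈ p∈ (~-sym p~q))
    covers (inj₂ p∈) (inj₂ q∈) p~q = Q.covers p∈ q∈ p~q

  add : ∀ {x τ g S} → All (Cov τ) S → Placement g S → Placement (x ∷ g) (τ ∷ S)
  add {x} {τ} τ-covers P = record
    { pairs = (x , τ) ∷ P.pairs ; labels = prep x P.labels ; places = prep τ P.places ; covers = covers }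
    where
    module P = Placement P
    from-τ : ∀ {q} → q ∈ P.pairs → Cov τ (proj₂ q)
    from-τ q∈ = All.lookup τ-covers (∈-resp-↭ P.places (∈-map⁺ proj₂ q∈))
    covers : ∀ {p q} → p ∈ (x , τ) ∷ P.pairs → q ∈ (x , τ) ∷ P.pairs →
             proj₁ p ~ proj₁ q → Cov (proj₂ p) (proj₂ q)
    covers (here refl) (here refl) x~x = ⊥-elim (~-irrefl x~x)
    covers (here refl) (there q∈)  _   = from-τ q∈
    covers (there p∈)  (here refl) _   = Cov-sym (from-τ p∈)
    covers (there p∈)  (there q∈)  p~q = P.covers p∈ q∈ p~q

  Hosts : List V → Set
  Hosts S = ∀ g → Unique g → length g ≡ length S → Placement g S

  hosts-clique : ∀ S → (∀ {a b} → a ∈ S → b ∈ S → Cov a b) → Hosts S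
  hosts-clique []      _      []      _ _ = record { pairs = [] ; labels = ↭-refl ; places = ↭-refl ; covers = λ () }
  hosts-clique (a ∷ S) clique (x ∷ g) (_ ∷ ug) |g| =
    add (All.tabulate (λ b∈ → clique (here refl) (there b∈)))
        (hosts-clique S (λ a∈ b∈ → clique (there a∈) (there b∈)) g ug (suc-injective |g|))

  -- The vertex removed by the split goes to `τ`, which covers all other places, so only the pieces
  -- need hosts. Two pieces cut inside `bs`; three pieces cut `w` and `s`, and the middle one gets
  -- an interval around the whole of `bs`.
  hosts-step : ∀ τ w bs s → All (Cov τ) w → All (Cov τ) bs → All (Cov τ) s →
    (∀ w₁ w₂ → w ≡ w₁ ++ w₂ → Hosts w₁) →
    (∀ s₁ s₂ → s ≡ s₁ ++ s₂ → Hosts s₂) →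
    (∀ es fs → bs ≡ es ++ fs → Hosts (w ++ es) × Hosts (fs ++ s)) →
    (∀ w₁ w₂ s₁ s₂ → w ≡ w₁ ++ w₂ → s ≡ s₁ ++ s₂ →
      length w₂ + length s₁ ≤ length w₁ → length w₂ + length s₁ ≤ length s₂ →
      Hosts (w₂ ++ bs ++ s₁)) →
    Hosts (w ++ (τ ∷ bs) ++ s)
  hosts-step τ w bs s τw τbs τs left right cut middle g ug |g| = place (split acyclic (length w) (length bs) (length s) g ug size)
    where
    open CommutativeMonoidSolver (++-commutativeMonoid {A = V})
    size : length g ≡ suc (length w + (length bs + length s))
    size = trans |g| (trans (length-++ w) (trans (+-suc (length w) _)
             (cong (λ n → suc (length w + n)) (length-++ bs))))
    place : Split (length w) (length bs) (length s) g → Placement g (w ++ (τ ∷ bs) ++ s)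
    place (two x L R i j σ L∥R |L| |R| i+j) with split-at bs i j (sym i+j)
    ... | es , fs , bs≡ , refl , refl = relocate (↭-sym σ) arrange
      (add (All.++⁺ (All.++⁺ τw (All.++⁻ˡ es τbs′)) (All.++⁺ (All.++⁻ʳ es τbs′) τs))
        (join L∥R (proj₁ (cut es fs bs≡) L (proj₁ uLR) (trans |L| (sym (length-++ w))))
                  (proj₂ (cut es fs bs≡) R (proj₂ uLR) (trans |R| (sym (length-++ fs))))))
      where
      τbs′ = subst (All (Cov τ)) bs≡ τbs
      uLR : Unique L × Unique R
      uLR with Unique-resp-↭ σ ug
      ... | _ ∷ u = Unique-++⁻ L u
      arrange : τ ∷ (w ++ es) ++ (fs ++ s) ↭ w ++ (τ ∷ bs) ++ s
      arrange = ↭-trans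
        (prep τ (↭-trans (solve 4 (λ w es fs s → (w ⊕ es) ⊕ (fs ⊕ s) ⊜ w ⊕ (es ⊕ fs) ⊕ s) ↭-refl w es fs s)
                         (↭-reflexive (cong (λ bs → w ++ bs ++ s) (sym bs≡)))))
        (↭-sym (shift τ w (bs ++ s)))
    place (three x L X R l₁ l₂ r₁ r₂ σ L∥X L∥R X∥R l≡ r≡ |L| |X| |R| ≤l₁ ≤r₂)
      with split-at w l₁ l₂ l≡ | split-at s r₁ r₂ r≡
    ... | w₁ , w₂ , w≡ , refl , refl | s₁ , s₂ , s≡ , refl , refl = relocate (↭-sym σ) arrange
      (add (All.++⁺ (All.++⁻ˡ w₁ τw′) (All.++⁺ (All.++⁺ (All.++⁻ʳ w₁ τw′) (All.++⁺ τbs (All.++⁻ˡ s₁ τs′))) (All.++⁻ʳ s₁ τs′)))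
        (join (∥-++ L∥X L∥R) (left w₁ w₂ w≡ L (proj₁ uL) |L|)
          (join X∥R (middle w₁ w₂ s₁ s₂ w≡ s≡ ≤l₁ ≤r₂ X (proj₁ uXR)
                      (trans |X| (sym (trans (length-++ w₂) (cong (length w₂ +_) (length-++ bs))))))
                    (right s₁ s₂ s≡ R (proj₂ uXR) |R|))))
      where
      τw′ = subst (All (Cov τ)) w≡ τw
      τs′ = subst (All (Cov τ)) s≡ τs
      uL : Unique L × Unique (X ++ R)
      uL with Unique-resp-↭ σ ug
      ... | _ ∷ u = Unique-++⁻ L u
      uXR = Unique-++⁻ X (proj₂ uL)
      arrange : τ ∷ w₁ ++ (w₂ ++ bs ++ s₁) ++ s₂ ↭ w ++ (τ ∷ bs) ++ s
      arrange = ↭-trans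
        (prep τ (↭-trans (solve 5 (λ w₁ w₂ bs s₁ s₂ → w₁ ⊕ (w₂ ⊕ bs ⊕ s₁) ⊕ s₂ ⊜ (w₁ ⊕ w₂) ⊕ bs ⊕ (s₁ ⊕ s₂)) ↭-refl w₁ w₂ bs s₁ s₂)
                         (↭-reflexive (cong₂ (λ w s → w ++ bs ++ s) (sym w≡) (sym s≡)))))
        (↭-sym (shift τ w (bs ++ s)))

  module Cross (jl L st R jr : List V) {jl′ jr′ : List V} (jl′⊆ : jl′ ⊆ jl) (jr′⊆ : jr′ ⊆ jr)
    (leftInfix  : ∀ p w q → p ++ w ++ q ≡ jl′ ++ L → Hosts w)
    (leftEnd    : ∀ p w es → p ++ w ≡ jl′ ++ L → es ⊆ st → Hosts (w ++ es))
    (rightInfix : ∀ p s q → p ++ s ++ q ≡ R ++ jr′ → Hosts s)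
    (rightStart : ∀ s q es → s ++ q ≡ R ++ jr′ → es ⊆ st → Hosts (es ++ s))
    where

    open Reach

    cross-step : ∀ {τ bs x y} → All (Cov τ) st → Reach jl L R jr τ x y → τ ∷ bs ⊆ st →
      ∀ p w s q → p ++ w ≡ jl′ ++ L → s ++ q ≡ R ++ jr′ → length w ≤ x → length s ≤ y →
      (∀ w₁ w₂ s₁ s₂ → w ≡ w₁ ++ w₂ → s ≡ s₁ ++ s₂ →
        length w₂ + length s₁ ≤ length w₁ → length w₂ + length s₁ ≤ length s₂ →
        Hosts (w₂ ++ bs ++ s₁)) →
      Hosts (w ++ (τ ∷ bs) ++ s)
    cross-step {τ} {bs} τst reach τbs⊆ p w s q pw sq |w| |s| middle =
      hosts-step τ w bs s
        (reachˡ reach jl′⊆ p w pw |w|)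
        (⊆.All-resp-⊆ bs⊆ τst)
        (reachʳ reach jr′⊆ s q sq |s|)
        (λ w₁ w₂ w≡ → leftInfix p w₁ w₂ (trans (cong (p ++_) (sym w≡)) pw))
        (λ s₁ s₂ s≡ → rightInfix s₁ s₂ q (trans (sym (++-assoc s₁ s₂ q)) (trans (cong (_++ q) (sym s≡)) sq)))
        (λ es fs bs≡ → leftEnd p w es pw (⊆-trans (⊆-trans (⊆.++⁺ʳ fs ⊆-refl) (⊆-reflexive (sym bs≡))) bs⊆)
                     , rightStart s q fs sq (⊆-trans (⊆-trans (⊆.++⁺ˡ es ⊆-refl) (⊆-reflexive (sym bs≡))) bs⊆))
        middle
      where
      bs⊆ : bs ⊆ st
      bs⊆ = ⊆-trans (τ ∷ʳ ⊆-refl) τbs⊆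

    -- A first step leaves 2|w₂| + |s₁| ≤ x, which halves the reach; a second leaves 5|w₄| + 4|s₃| ≤
    -- x. Two independent halvings would give only a factor four: the fifth share comes from |s₁|,
    -- which the second step bounds from below.
    cross : ∀ {x y ts} → Chain jl L st R jr x y ts → ts ⊆ st →
      ∀ p w s q → p ++ w ≡ jl′ ++ L → s ++ q ≡ R ++ jr′ → length w ≤ x → length s ≤ y →
      Hosts (w ++ ts ++ s)
    cross end ts⊆ p [] s q _ sq _ _ = rightStart s q _ sq ts⊆
    cross {x} {y} (pair {τ₁ = τ₁} {τ₂} {ts} st₁ reach₁ st₂ reach₂ chain) ts⊆ p w s q pw sq |w| |s| =
      cross-step st₁ reach₁ ts⊆ p w s q pw sq |w| |s| λ where
        w₁ w₂ s₁ s₂ refl refl ≤w₁ ≤s₂ →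
          cross-step st₂ reach₂ (⊆-trans (τ₁ ∷ʳ ⊆-refl) ts⊆) (p ++ w₁) w₂ s₁ (s₂ ++ q)
            (trans (++-assoc p w₁ w₂) pw) (trans (sym (++-assoc s₁ s₂ q)) sq)
            (*≤⇒≤/ (length w₂) 2 (≤-trans (2a≤ (length w₂) (length s₁)) (2w₂+s₁≤x w₁ w₂ (length s₁) |w| ≤w₁)))
            (*≤⇒≤/ (length s₁) 2 (≤-trans (2a≤ (length s₁) (length w₂)) (2s₁+w₂≤y s₁ s₂ (length w₂) |s| ≤s₂)))
            λ where
            w₃ w₄ s₃ s₄ refl refl ≤w₃ ≤s₄ →
              cross chain (⊆-trans (τ₂ ∷ʳ ⊆-refl) (⊆-trans (τ₁ ∷ʳ ⊆-refl) ts⊆))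
                ((p ++ w₁) ++ w₃) w₄ s₃ (s₄ ++ s₂ ++ q)
                (trans (++-assoc (p ++ w₁) w₃ w₄) (trans (++-assoc p w₁ (w₃ ++ w₄)) pw))
                (trans (sym (++-assoc s₃ s₄ (s₂ ++ q))) (trans (sym (++-assoc (s₃ ++ s₄) s₂ q)) sq))
                (*≤⇒≤/ (length w₄) 5 (fifth (length w₄) (length s₃) (length w₃) (length s₄)
                  ≤w₃ ≤s₄ (subst₂ (λ a b → 2 * a + b ≤ x) (length-++ w₃) (length-++ s₃)
                    (2w₂+s₁≤x w₁ (w₃ ++ w₄) (length (s₃ ++ s₄)) |w| ≤w₁))))
                (*≤⇒≤/ (length s₃) 5 (fifth′ (length w₄) (length s₃) (length w₃) (length s₄)
                  ≤w₃ ≤s₄ (subst₂ (λ a b → 2 * a + b ≤ y) (length-++ s₃) (length-++ w₃)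
                    (2s₁+w₂≤y (s₃ ++ s₄) s₂ (length (w₃ ++ w₄)) |s| ≤s₂))))
      where
      open ℕ.+-*-Solver renaming (solve to solveℕ)
      open ≤-Reasoning
      2a≤ : ∀ a b → a * 2 ≤ 2 * a + b
      2a≤ a b = ≤-trans (≤-reflexive (*-comm a 2)) (m≤m+n (2 * a) b)
      2w₂+s₁≤x : ∀ w₁ w₂ b → length (w₁ ++ w₂) ≤ x → length w₂ + b ≤ length w₁ → 2 * length w₂ + b ≤ x
      2w₂+s₁≤x w₁ w₂ b |w| le = begin
        2 * length w₂ + b           ≡⟨ solveℕ 2 (λ a b → con 2 :* a :+ b := (a :+ b) :+ a) refl (length w₂) b ⟩
        length w₂ + b + length w₂   ≤⟨ +-monoˡ-≤ (length w₂) le ⟩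
        length w₁ + length w₂       ≡⟨ sym (length-++ w₁) ⟩
        length (w₁ ++ w₂)           ≤⟨ |w| ⟩
        x                           ∎
      2s₁+w₂≤y : ∀ s₁ s₂ b → length (s₁ ++ s₂) ≤ y → b + length s₁ ≤ length s₂ → 2 * length s₁ + b ≤ y
      2s₁+w₂≤y s₁ s₂ b |s| le = begin
        2 * length s₁ + b           ≡⟨ solveℕ 2 (λ a b → con 2 :* a :+ b := a :+ (b :+ a)) refl (length s₁) b ⟩
        length s₁ + (b + length s₁) ≤⟨ +-monoʳ-≤ (length s₁) le ⟩
        length s₁ + length s₂       ≡⟨ sym (length-++ s₁) ⟩
        length (s₁ ++ s₂)           ≤⟨ |s| ⟩
        y                           ∎
      fifth : ∀ a c d e {z} → a + c ≤ d → a + c ≤ e → 2 * (d + a) + (c + e) ≤ z → a * 5 ≤ z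
      fifth a c d e {z} ≤d ≤e le = begin
        a * 5                                   ≤⟨ m≤m+n (a * 5) (4 * c) ⟩
        a * 5 + 4 * c                           ≡⟨ solveℕ 2 (λ a c → a :* con 5 :+ con 4 :* c := con 2 :* ((a :+ c) :+ a) :+ (c :+ (a :+ c))) refl a c ⟩
        2 * ((a + c) + a) + (c + (a + c))       ≤⟨ +-mono-≤ (*-monoʳ-≤ 2 (+-monoˡ-≤ a ≤d)) (+-monoʳ-≤ c ≤e) ⟩
        2 * (d + a) + (c + e)                   ≤⟨ le ⟩
        z                                       ∎
      fifth′ : ∀ a c d e {z} → a + c ≤ d → a + c ≤ e → 2 * (c + e) + (d + a) ≤ z → c * 5 ≤ z
      fifth′ a c d e {z} ≤d ≤e le = begin
        c * 5                                   ≤⟨ m≤m+n (c * 5) (4 * a) ⟩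
        c * 5 + 4 * a                           ≡⟨ solveℕ 2 (λ a c → c :* con 5 :+ con 4 :* a := con 2 :* (c :+ (a :+ c)) :+ ((a :+ c) :+ a)) refl a c ⟩
        2 * (c + (a + c)) + ((a + c) + a)       ≤⟨ +-mono-≤ (*-monoʳ-≤ 2 (+-monoʳ-≤ c ≤e)) (+-monoˡ-≤ a ≤d) ⟩
        2 * (c + e) + (d + a)                   ≤⟨ le ⟩
        z                                       ∎

  -- Induction on the hub. An interval running from the left line across the stack into the right
  -- one is handled by the chain; any other lies within one of the two lines together with the
  -- stack, which is an end stack of both.
  hub-hosts : ∀ {jl line jr jl′ jr′} → Hub jl line jr → jl′ ⊆ jl → jr′ ⊆ jr →
    ∀ p S q → p ++ S ++ q ≡ jl′ ++ line ++ jr′ → Hosts S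
  hub-hosts {jl} {line} {jr} {jl′} {jr′} (leaf clique) jl′⊆ jr′⊆ p S q eq =
    hosts-clique S (λ a∈ b∈ → clique (within a∈) (within b∈))
    where
    within : ∀ {a} → a ∈ S → a ∈ jl ++ line ++ jr
    within a∈ = ⊆.Any-resp-⊆ (⊆.++⁺ jl′⊆ (⊆.++⁺ (⊆-refl {x = line}) jr′⊆))
                  (subst (_ ∈_) eq (∈-++⁺ʳ p (∈-++⁺ˡ a∈)))
  hub-hosts {jl} {jr = jr} {jl′} {jr′} (node {L = L} {st} {R} |L| |R| chain hubL hubR) jl′⊆ jr′⊆ p S q eq =
    locate (++-split p regroup)
    where
    regroup : p ++ (S ++ q) ≡ (jl′ ++ L) ++ (st ++ (R ++ jr′))
    regroup = trans eq (trans (cong (jl′ ++_) (trans (++-assoc L (st ++ R) jr′) (cong (L ++_) (++-assoc st R jr′))))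
                              (sym (++-assoc jl′ L (st ++ R ++ jr′))))

    inLeft : ∀ p S q {es} → es ⊆ st → p ++ S ++ q ≡ (jl′ ++ L) ++ es → Hosts S
    inLeft p S q {es} es⊆ eq = hub-hosts hubL jl′⊆ es⊆ p S q (trans eq (++-assoc jl′ L es))

    inRight : ∀ p S q {es} → es ⊆ st → p ++ S ++ q ≡ es ++ (R ++ jr′) → Hosts S
    inRight p S q es⊆ eq = hub-hosts hubR es⊆ jr′⊆ p S q eq

    ++[] : {B : Set} {xs : List B} → xs ++ [] ≡ xs
    ++[] = ++-identityʳ _

    open Cross jl L st R jr jl′⊆ jr′⊆
      (λ p w q eq → inLeft p w q (minimum _) (trans eq (sym ++[])))
      (λ p w es eq es⊆ → inLeft p (w ++ es) [] es⊆ (trans (cong (p ++_) ++[]) (trans (sym (++-assoc p w es)) (cong (_++ es) eq))))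
      (λ p s q eq → inRight p s q (minimum _) eq)
      (λ s q es eq es⊆ → inRight [] (es ++ s) q es⊆ (trans (++-assoc es s q) (cong (es ++_) eq)))

    length-suffix : ∀ (p : List V) {w u} → p ++ w ≡ u → length w ≤ length u
    length-suffix p refl = ≤-trans (m≤n+m _ (length p)) (≤-reflexive (sym (length-++ p)))

    length-prefix : ∀ (s : List V) {q u} → s ++ q ≡ u → length s ≤ length u
    length-prefix s refl = ≤-trans (m≤m+n (length s) _) (≤-reflexive (sym (length-++ s)))

    sublist-length : ∀ {xs ys : List V} → xs ⊆ ys → length xs ≤ length ys
    sublist-length = ⊆.length-mono-≤

    across : ∀ p w s q → p ++ w ≡ jl′ ++ L → s ++ q ≡ R ++ jr′ → Hosts (w ++ st ++ s)
    across p w s q pw sq = cross chain ⊆-refl p w s q pw sq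
      (≤-trans (length-suffix p pw) (≤-trans (sublist-length (⊆.++⁺ jl′⊆ ⊆-refl)) |L|))
      (≤-trans (length-prefix s sq) (≤-trans (sublist-length (⊆.++⁺ (⊆-refl {x = R}) jr′⊆)) |R|))

    locate₃ : ∀ w s → jl′ ++ L ≡ p ++ w → S ≡ w ++ s → s ++ q ≡ st ++ (R ++ jr′) → Hosts S
    locate₃ w s U≡ refl s≡ with ++-split s {us = st} s≡
    ... | inj₁ (v , st≡ , q≡) = inLeft p (w ++ s) v ⊆-refl (begin
      p ++ (w ++ s) ++ v    ≡⟨ cong (p ++_) (++-assoc w s v) ⟩
      p ++ w ++ (s ++ v)    ≡⟨ cong (λ z → p ++ w ++ z) (sym st≡) ⟩
      p ++ w ++ st          ≡⟨ sym (++-assoc p w st) ⟩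
      (p ++ w) ++ st        ≡⟨ cong (_++ st) (sym U≡) ⟩
      (jl′ ++ L) ++ st      ∎)
      where open ≡-Reasoning
    ... | inj₂ (v , refl , W≡) = across p w v q (sym U≡) (sym W≡)

    locate₂ : ∀ w → jl′ ++ L ≡ p ++ w → S ++ q ≡ w ++ (st ++ (R ++ jr′)) → Hosts S
    locate₂ w U≡ Sq≡ with ++-split S {us = w} Sq≡
    ... | inj₁ (v , refl , _) = inLeft p S v {es = []} (minimum _) (trans (sym U≡) (sym ++[]))
    ... | inj₂ (v , S≡ , eq′) = locate₃ w v U≡ S≡ (sym eq′)

    locate : (∃[ w ] jl′ ++ L ≡ p ++ w × S ++ q ≡ w ++ (st ++ (R ++ jr′)))
           ⊎ (∃[ w ] p ≡ (jl′ ++ L) ++ w × st ++ (R ++ jr′) ≡ w ++ (S ++ q)) → Hosts S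
    locate (inj₁ (w , U≡ , Sq≡)) = locate₂ w U≡ Sq≡
    locate (inj₂ (w , _ , eq′))  = inRight w S q ⊆-refl (sym eq′)

-- The construction and the number of its edges

-- The binary length of `w`. A stack of `2 * bits w` vertices provides `bits w` pairs, enough to
-- bring a reach of at most `w` down to 0.
bits : ℕ → ℕ
bits zero    = 0
bits (suc w) with suc w <? 2 ^ bits w
... | yes _ = bits w
... | no  _ = suc (bits w)

<2^bits : ∀ w → w < 2 ^ bits w
<2^bits zero = s≤s z≤n
<2^bits (suc w) with suc w <? 2 ^ bits w
... | yes lt = lt
... | no  _  = begin-strict
  suc w                   ≤⟨ <2^bits w ⟩
  2 ^ bits w              <⟨ m<m+n (2 ^ bits w) (≤-trans (m^n>0 2 (bits w)) (m≤m+n _ 0)) ⟩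
  2 * 2 ^ bits w          ∎
  where open ≤-Reasoning

2^bits≤ : ∀ w → 2 ^ bits w ≤ suc (2 * w)
2^bits≤ zero = ≤-refl
2^bits≤ (suc w) with suc w <? 2 ^ bits w
... | yes _  = ≤-trans (2^bits≤ w) (s≤s (*-monoʳ-≤ 2 (n≤1+n w)))
... | no  ge = ≤-trans (*-monoʳ-≤ 2 (≮⇒≥ ge)) (n≤1+n _)

-- The constant 4 is attained at n = 4; from there on, doubling outgrows the cube since (n + 1)³ ≤
-- 2n³.
n³≤4*2^n : ∀ n → n * (n * n) ≤ 4 * 2 ^ n
n³≤4*2^n 0 = z≤n
n³≤4*2^n 1 = m≤m+n 1 7
n³≤4*2^n 2 = m≤m+n 8 8
n³≤4*2^n 3 = m≤m+n 27 5
n³≤4*2^n (suc (suc (suc (suc u)))) = from-4 u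
  where
  open ≤-Reasoning
  open ℕ.+-*-Solver renaming (solve to solveℕ)
  from-4 : ∀ u → (4 + u) * ((4 + u) * (4 + u)) ≤ 4 * 2 ^ (4 + u)
  from-4 zero    = ≤-refl
  from-4 (suc u) = begin
    (5 + u) * ((5 + u) * (5 + u))
      ≤⟨ m≤m+n _ (3 + 21 * u + 9 * (u * u) + u * (u * u)) ⟩
    (5 + u) * ((5 + u) * (5 + u)) + (3 + 21 * u + 9 * (u * u) + u * (u * u))
      ≡⟨ solveℕ 1 (λ u → (con 5 :+ u) :* ((con 5 :+ u) :* (con 5 :+ u)) :+ (con 3 :+ con 21 :* u :+ con 9 :* (u :* u) :+ u :* (u :* u))
           := con 2 :* ((con 4 :+ u) :* ((con 4 :+ u) :* (con 4 :+ u)))) refl u ⟩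
    2 * ((4 + u) * ((4 + u) * (4 + u)))
      ≤⟨ *-monoʳ-≤ 2 (from-4 u) ⟩
    2 * (4 * 2 ^ (4 + u))
      ≡⟨ solveℕ 1 (λ p → con 2 :* (con 4 :* p) := con 4 :* (con 2 :* p)) refl (2 ^ (4 + u)) ⟩
    4 * (2 * 2 ^ (4 + u)) ∎

-- Up to n = 4c the constant dominates; beyond it one factor n replaces 4c and the cubic bound
-- applies.
square≤2^ : ∀ c n → c * (n * n) ≤ 2 ^ n + c * ((4 * c) * (4 * c))
square≤2^ c n with ≤-total n (4 * c)
... | inj₁ n≤4c = ≤-trans (*-monoʳ-≤ c (*-mono-≤ n≤4c n≤4c)) (m≤n+m _ (2 ^ n))
... | inj₂ 4c≤n = ≤-trans (*-cancelˡ-≤ 4 (begin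
  4 * (c * (n * n)) ≡⟨ sym (*-assoc 4 c (n * n)) ⟩
  4 * c * (n * n)   ≤⟨ *-monoˡ-≤ (n * n) 4c≤n ⟩
  n * (n * n)       ≤⟨ n³≤4*2^n n ⟩
  4 * 2 ^ n         ∎)) (m≤m+n (2 ^ n) _)
  where open ≤-Reasoning

bits²-sublinear : ∀ c → ∃[ D ] (∀ w → c * (bits w * bits w) ≤ w + D)
bits²-sublinear c = suc E , λ w → *-cancelˡ-≤ 2 (begin
  2 * (c * (bits w * bits w)) ≡⟨ sym (*-assoc 2 c _) ⟩
  2 * c * (bits w * bits w)   ≤⟨ square≤2^ (2 * c) (bits w) ⟩
  2 ^ bits w + E              ≤⟨ +-monoˡ-≤ E (2^bits≤ w) ⟩
  suc (2 * w) + E             ≤⟨ m≤m+n _ (suc E) ⟩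
  suc (2 * w) + E + suc E     ≡⟨ solveℕ 2 (λ w E → con 1 :+ con 2 :* w :+ E :+ (con 1 :+ E) := con 2 :* (w :+ (con 1 :+ E))) refl w E ⟩
  2 * (w + suc E)             ∎)
  where
  open ≤-Reasoning
  open ℕ.+-*-Solver renaming (solve to solveℕ)
  E = 2 * c * ((4 * (2 * c)) * (4 * (2 * c)))

-- The slack is the square of the difference, which is why the two numbers are ordered first.
[a+b]²≤ : ∀ a b → (a + b) * (a + b) ≤ 2 * (a * a + b * b)
[a+b]²≤ a b = wlog (≤-total a b)
  where
  open ℕ.+-*-Solver renaming (solve to solveℕ)
  open ≤-Reasoning
  ordered : ∀ a d → (a + (a + d)) * (a + (a + d)) ≤ 2 * (a * a + (a + d) * (a + d))
  ordered a d = begin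
    (a + (a + d)) * (a + (a + d))           ≤⟨ m≤m+n _ (d * d) ⟩
    (a + (a + d)) * (a + (a + d)) + d * d   ≡⟨ solveℕ 2 (λ a d → (a :+ (a :+ d)) :* (a :+ (a :+ d)) :+ d :* d := con 2 :* (a :* a :+ (a :+ d) :* (a :+ d))) refl a d ⟩
    2 * (a * a + (a + d) * (a + d))         ∎
  wlog : a ≤ b ⊎ b ≤ a → (a + b) * (a + b) ≤ 2 * (a * a + b * b)
  wlog (inj₁ a≤b) = subst (λ b → (a + b) * (a + b) ≤ 2 * (a * a + b * b)) (m+[n∸m]≡n a≤b) (ordered a (b ∸ a))
  wlog (inj₂ b≤a) = subst₂ _≤_ (cong₂ _*_ (+-comm b a) (+-comm b a)) (cong (2 *_) (+-comm (b * b) (a * a)))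
    (subst (λ a → (b + a) * (b + a) ≤ 2 * (b * b + a * a)) (m+[n∸m]≡n b≤a) (ordered b (a ∸ b)))

-- A line of m vertices between stacks of a and b vertices receives a stack of s vertices; the
-- stacks are thin if they are negligible compared with the line.
Thin : (κ a m b : ℕ) → Set
Thin κ a m b = (2 * κ + 48) * (s * s) + 90 * (a + b) ≤ 5 * m
  where s = 2 * bits (a + (m + b))

-- A line that is not thin becomes a clique. Its edges are paid by a constant and by a potential of
-- its end stacks, charged when those stacks were created.
ThickBound : (κ K : ℕ) → Set
ThickBound κ K = ∀ a m b → ¬ Thin κ a m b →
  48 * ((a + (m + b)) * (a + (m + b))) ≤ K + κ * (a * a + b * b)

-- On a line that is not thin, 5m is at most a multiple of a squared logarithm plus 90(a + b). The
-- former is at most w + D, whence w ≤ D + 24(a + b). Here `D` depends on κ but 24 does not, so the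
-- requirement on κ is absolute: 48 · 2 · 24² · 2.
thick-small : ∀ κ → 96 * (576 * 2) ≤ κ → ∃[ K ] 96 ≤ K × ThickBound κ K
thick-small κ κ≥ with bits²-sublinear (4 * (2 * κ + 48))
... | D , sublinear = 96 + 96 * (D * D) , m≤m+n 96 _ , bound
  where
  open ≤-Reasoning
  open ℕ.+-*-Solver renaming (solve to solveℕ)
  bound : ThickBound κ (96 + 96 * (D * D))
  bound a m b ¬thin = begin
    48 * (w * w)                              ≤⟨ *-monoʳ-≤ 48 (*-mono-≤ w≤ w≤) ⟩
    48 * ((D + 24 * z) * (D + 24 * z))        ≤⟨ *-monoʳ-≤ 48 ([a+b]²≤ D (24 * z)) ⟩
    48 * (2 * (D * D + 24 * z * (24 * z)))    ≡⟨ solveℕ 2 (λ D z → con 48 :* (con 2 :* (D :* D :+ con 24 :* z :* (con 24 :* z))) := con 96 :* (D :* D) :+ con 96 :* (con 576 :* (z :* z))) refl D z ⟩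
    96 * (D * D) + 96 * (576 * (z * z))       ≤⟨ +-mono-≤ (m≤n+m (96 * (D * D)) 96) (*-monoʳ-≤ 96 (*-monoʳ-≤ 576 ([a+b]²≤ a b))) ⟩
    96 + 96 * (D * D) + 96 * (576 * (2 * q))  ≡⟨ cong (96 + 96 * (D * D) +_) (trans (cong (96 *_) (sym (*-assoc 576 2 q))) (sym (*-assoc 96 (576 * 2) q))) ⟩
    96 + 96 * (D * D) + 96 * (576 * 2) * q    ≤⟨ +-monoʳ-≤ (96 + 96 * (D * D)) (*-monoˡ-≤ q κ≥) ⟩
    96 + 96 * (D * D) + κ * q                 ∎
    where
    w = a + (m + b)
    t = bits w
    z = a + b
    q = a * a + b * b
    c = 4 * (2 * κ + 48)
    5m≤ : 5 * m ≤ c * (t * t) + 90 * z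
    5m≤ = ≤-trans (<⇒≤ (≰⇒> ¬thin)) (≤-reflexive (cong (_+ 90 * z)
      (solveℕ 2 (λ M t → M :* ((con 2 :* t) :* (con 2 :* t)) := con 4 :* M :* (t :* t)) refl (2 * κ + 48) t)))
    w≤ : w ≤ D + 24 * z
    w≤ = *-cancelˡ-≤ 4 (+-cancelˡ-≤ w _ _ (begin
      w + 4 * w                    ≡⟨ solveℕ 3 (λ a m b → (a :+ (m :+ b)) :+ con 4 :* (a :+ (m :+ b)) := con 5 :* m :+ con 5 :* (a :+ b)) refl a m b ⟩
      5 * m + 5 * z                ≤⟨ +-monoˡ-≤ (5 * z) 5m≤ ⟩
      c * (t * t) + 90 * z + 5 * z ≤⟨ +-monoˡ-≤ (5 * z) (+-monoˡ-≤ (90 * z) (sublinear w)) ⟩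
      w + D + 90 * z + 5 * z       ≤⟨ m≤m+n _ (3 * D + z) ⟩
      w + D + 90 * z + 5 * z + (3 * D + z) ≡⟨ solveℕ 3 (λ w D z → w :+ D :+ con 90 :* z :+ con 5 :* z :+ (con 3 :* D :+ z) := w :+ con 4 :* (D :+ con 24 :* z)) refl w D z ⟩
      w + 4 * (D + 24 * z)         ∎))

length-cartesianProduct : {A B : Set} (xs : List A) (ys : List B) →
  length (cartesianProduct xs ys) ≡ length xs * length ys
length-cartesianProduct []       ys = refl
length-cartesianProduct (x ∷ xs) ys = trans (length-++ (map (x ,_) ys))
  (cong₂ _+_ (length-map (x ,_) ys) (length-cartesianProduct xs ys))

-- The edge set and its size

module Construction {V : Set} (κ : ℕ) where

  pairs : List V → List (V × V)
  pairs W = cartesianProduct W W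

  star : V → List V → List (V × V)
  star τ = map (τ ,_)

  lastN : ℕ → List V → List V
  lastN x U = drop (length U ∸ x) U

  chainEdges : ℕ → ℕ → (U st W ts : List V) → List (V × V)
  chainEdges x y U st W (τ₁ ∷ τ₂ ∷ ts) =
    star τ₁ (st ++ lastN x U ++ take y W) ++
    star τ₂ (st ++ lastN (x / 2) U ++ take (y / 2) W) ++
    chainEdges (x / 5) (y / 5) U st W ts
  chainEdges _ _ _ _ _ _ = []

  width : (jl line jr : List V) → ℕ
  width jl line jr = length jl + (length line + length jr)

  stackSize : (jl line jr : List V) → ℕ
  stackSize jl line jr = 2 * bits (width jl line jr)

  Fits : (jl line jr : List V) → Set
  Fits jl line jr = Thin κ (length jl) (length line) (length jr)

  half : (jl line jr : List V) → ℕ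
  half jl line jr = ⌊ length line ∸ stackSize jl line jr /2⌋

  leftPart stack rightPart : (jl line jr : List V) → List V
  leftPart  jl line jr = take (half jl line jr) line
  stack     jl line jr = take (stackSize jl line jr) (drop (half jl line jr) line)
  rightPart jl line jr = drop (stackSize jl line jr) (drop (half jl line jr) line)

  -- The number bounds the depth of the recursion. It is used with at most 2^i vertices on the line,
  -- so at depth 0 at most one vertex separates the end stacks and a clique is affordable.
  edges : ℕ → (jl line jr : List V) → List (V × V)
  edges zero    jl line jr = pairs (jl ++ line ++ jr)
  edges (suc i) jl line jr with
    (2 * κ + 48) * (stackSize jl line jr * stackSize jl line jr) + 90 * (length jl + length jr) ≤? 5 * length line
  ... | no  _ = pairs (jl ++ line ++ jr)
  ... | yes _ = chainEdges (length (jl ++ L)) (length (R ++ jr)) (jl ++ L) st (R ++ jr) st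
                ++ edges i jl L st ++ edges i st R jr
    where
    L  = leftPart jl line jr
    st = stack jl line jr
    R  = rightPart jl line jr

  module _ (jl line jr : List V) (fits : Fits jl line jr) where
    private
      s = stackSize jl line jr
      m = length line
      h = half jl line jr
      j = length jl + length jr

    -- Thinness provides room: the stack fits, and each half is at least as long as both end stacks
    -- together, which later keeps all reaches but the first out of the end stacks.
    2j+s≤m : 2 * j + s ≤ m
    2j+s≤m = *-cancelˡ-≤ 5 (begin
      5 * (2 * j + s)                  ≡⟨ *-distribˡ-+ 5 (2 * j) s ⟩
      5 * (2 * j) + 5 * s              ≡⟨ cong (_+ 5 * s) (sym (*-assoc 5 2 j)) ⟩
      10 * j + 5 * s                   ≤⟨ +-mono-≤ (*-monoˡ-≤ j (m≤m+n 10 80)) (*-mono-≤ (≤-trans (m≤m+n 5 43) (m≤n+m 48 (2 * κ))) (s≤s² s)) ⟩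
      90 * j + (2 * κ + 48) * (s * s)  ≡⟨ +-comm (90 * j) _ ⟩
      (2 * κ + 48) * (s * s) + 90 * j  ≤⟨ fits ⟩
      5 * m                            ∎)
      where
      open ≤-Reasoning
      s≤s² : ∀ s → s ≤ s * s
      s≤s² zero    = z≤n
      s≤s² (suc s) = m≤m+n (suc s) (s * suc s)

    s≤m : s ≤ m
    s≤m = ≤-trans (m≤n+m s (2 * j)) 2j+s≤m

    j≤half : j ≤ h
    j≤half = subst (_≤ h) (sym (n≡⌊n+n/2⌋ j)) (⌊n/2⌋-mono (m+n≤o⇒m≤o∸n (j + j)
      (subst (λ k → k + s ≤ m) (cong (j +_) (+-identityʳ j)) 2j+s≤m)))

    half≤ : h ≤ m ∸ s
    half≤ = ⌊n/2⌋≤n (m ∸ s)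

    length-left : length (leftPart jl line jr) ≡ h
    length-left = trans (length-take h line) (m≤n⇒m⊓n≡m (≤-trans half≤ (m∸n≤m m s)))

    s≤m∸h : s ≤ m ∸ h
    s≤m∸h = m+n≤o⇒m≤o∸n s (≤-trans (+-monoʳ-≤ s half≤) (≤-reflexive (m+[n∸m]≡n s≤m)))

    length-stack : length (stack jl line jr) ≡ s
    length-stack = trans (length-take s (drop h line))
      (m≤n⇒m⊓n≡m (subst (s ≤_) (sym (length-drop h line)) s≤m∸h))

    length-right : length (rightPart jl line jr) ≡ ⌈ m ∸ s /2⌉
    length-right = begin
      length (drop s (drop h line)) ≡⟨ length-drop s (drop h line) ⟩
      length (drop h line) ∸ s      ≡⟨ cong (_∸ s) (length-drop h line) ⟩
      m ∸ h ∸ s                     ≡⟨ ∸-+-assoc m h s ⟩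
      m ∸ (h + s)                   ≡⟨ cong (m ∸_) (+-comm h s) ⟩
      m ∸ (s + h)                   ≡⟨ sym (∸-+-assoc m s h) ⟩
      m ∸ s ∸ h                     ≡⟨ cong (_∸ h) (sym (⌊n/2⌋+⌈n/2⌉≡n (m ∸ s))) ⟩
      h + ⌈ m ∸ s /2⌉ ∸ h           ≡⟨ m+n∸m≡n h _ ⟩
      ⌈ m ∸ s /2⌉                   ∎
      where open ≡-Reasoning

    reassemble : leftPart jl line jr ++ stack jl line jr ++ rightPart jl line jr ≡ line
    reassemble = trans (cong (leftPart jl line jr ++_) (take++drop≡id s (drop h line))) (take++drop≡id h line)

    jl≤left : length jl ≤ length (leftPart jl line jr)
    jl≤left = subst (length jl ≤_) (sym length-left) (≤-trans (m≤m+n (length jl) (length jr)) j≤half)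

    jr≤right : length jr ≤ length (rightPart jl line jr)
    jr≤right = subst (length jr ≤_) (sym length-right)
      (≤-trans (m≤n+m (length jr) (length jl)) (≤-trans j≤half (⌊n/2⌋≤⌈n/2⌉ (m ∸ s))))

    parts≤line : length (leftPart jl line jr) + length (rightPart jl line jr) ≤ m
    parts≤line = begin
      length (leftPart jl line jr) + length (rightPart jl line jr) ≡⟨ cong₂ _+_ length-left length-right ⟩
      h + ⌈ m ∸ s /2⌉                                              ≡⟨ ⌊n/2⌋+⌈n/2⌉≡n (m ∸ s) ⟩
      m ∸ s                                                        ≤⟨ m∸n≤m m s ⟩
      m                                                            ∎
      where open ≤-Reasoning

    right≤ : ∀ {i} → m ≤ 2 * i → length (rightPart jl line jr) ≤ i
    right≤ {i} m≤ = subst (_≤ i) (sym length-right) (subst (⌈ m ∸ s /2⌉ ≤_) (sym (n≡⌈n+n/2⌉ i))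
      (⌈n/2⌉-mono (≤-trans (m∸n≤m m s) (≤-trans m≤ (≤-reflexive (cong (i +_) (+-identityʳ i)))))))

    left≤ : ∀ {i} → m ≤ 2 * i → length (leftPart jl line jr) ≤ i
    left≤ m≤ = ≤-trans (≤-trans (≤-reflexive length-left) (≤-trans (⌊n/2⌋≤⌈n/2⌉ (m ∸ s)) (≤-reflexive (sym length-right)))) (right≤ m≤)

  length-star : ∀ τ x y U st W → length (star τ (st ++ lastN x U ++ take y W)) ≤ length st + (x + y)
  length-star τ x y U st W = begin
    length (star τ (st ++ lastN x U ++ take y W))      ≡⟨ length-map (τ ,_) (st ++ lastN x U ++ take y W) ⟩
    length (st ++ lastN x U ++ take y W)               ≡⟨ length-++ st ⟩
    length st + length (lastN x U ++ take y W)         ≡⟨ cong (length st +_) (length-++ (lastN x U)) ⟩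
    length st + (length (lastN x U) + length (take y W)) ≤⟨ +-monoʳ-≤ (length st) (+-mono-≤ last≤ take≤) ⟩
    length st + (x + y)                                ∎
    where
    open ≤-Reasoning
    take≤ : length (take y W) ≤ y
    take≤ = subst (_≤ y) (sym (length-take y W)) (m⊓n≤m y (length W))
    last≤ : length (lastN x U) ≤ x
    last≤ = subst (_≤ x) (sym (length-drop (length U ∸ x) U))
      (m≤n+o⇒m∸n≤o (length U) (length U ∸ x) (subst (length U ≤_) (+-comm x _) (m≤n+m∸n (length U) x)))

  -- 1 + 1/2 + 1/5 + 1/10 + 1/25 + … = 15/8.
  length-chain : ∀ x y U st W ts →
    8 * length (chainEdges x y U st W ts) ≤ 8 * (length ts * length st) + 15 * (x + y)
  length-chain x y U st W []       = z≤n
  length-chain x y U st W (_ ∷ []) = z≤n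
  length-chain x y U st W (τ₁ ∷ τ₂ ∷ ts) = begin
    8 * length (S₁ ++ S₂ ++ S₃)
      ≡⟨ cong (8 *_) (trans (length-++ S₁) (cong (length S₁ +_) (length-++ S₂))) ⟩
    8 * (length S₁ + (length S₂ + length S₃))
      ≡⟨ solveℕ 3 (λ a b c → con 8 :* (a :+ (b :+ c)) := con 8 :* a :+ con 8 :* b :+ con 8 :* c) refl (length S₁) (length S₂) (length S₃) ⟩
    8 * length S₁ + 8 * length S₂ + 8 * length S₃
      ≤⟨ +-mono-≤ (+-mono-≤ (*-monoʳ-≤ 8 (length-star τ₁ x y U st W)) (*-monoʳ-≤ 8 (length-star τ₂ (x / 2) (y / 2) U st W)))
                  (length-chain (x / 5) (y / 5) U st W ts) ⟩
    8 * (σ + (x + y)) + 8 * (σ + (x / 2 + y / 2)) + (8 * (t * σ) + 15 * (x / 5 + y / 5))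
      ≡⟨ solveℕ 7 (λ σ x y x₂ y₂ u z → con 8 :* (σ :+ (x :+ y)) :+ con 8 :* (σ :+ (x₂ :+ y₂)) :+ (con 8 :* u :+ con 15 :* z)
           := con 8 :* (con 2 :* σ :+ u) :+ (con 8 :* (x :+ y) :+ con 4 :* (x₂ :* con 2 :+ y₂ :* con 2) :+ con 3 :* (z :* con 5)))
           refl σ x y (x / 2) (y / 2) (t * σ) (x / 5 + y / 5) ⟩
    8 * (2 * σ + t * σ) + (8 * (x + y) + 4 * (x / 2 * 2 + y / 2 * 2) + 3 * ((x / 5 + y / 5) * 5))
      ≤⟨ +-monoʳ-≤ (8 * (2 * σ + t * σ)) (+-mono-≤ (+-monoʳ-≤ (8 * (x + y)) (*-monoʳ-≤ 4 (+-mono-≤ (m/n*n≤m x 2) (m/n*n≤m y 2))))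
           (*-monoʳ-≤ 3 (≤-trans (≤-reflexive (*-distribʳ-+ 5 (x / 5) (y / 5))) (+-mono-≤ (m/n*n≤m x 5) (m/n*n≤m y 5))))) ⟩
    -- The coefficient 15 solves c = 8 + 8/2 + c/5.
    8 * (2 * σ + t * σ) + (8 * (x + y) + 4 * (x + y) + 3 * (x + y))
      ≡⟨ solveℕ 3 (λ σ u z → con 8 :* (con 2 :* σ :+ u) :+ (con 8 :* z :+ con 4 :* z :+ con 3 :* z) := con 8 :* (σ :+ (σ :+ u)) :+ con 15 :* z) refl σ (t * σ) (x + y) ⟩
    8 * (σ + (σ + t * σ)) + 15 * (x + y) ∎
    where
    open ≤-Reasoning
    open ℕ.+-*-Solver renaming (solve to solveℕ)
    σ = length st
    t = length ts
    S₁ = star τ₁ (st ++ lastN x U ++ take y W)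
    S₂ = star τ₂ (st ++ lastN (x / 2) U ++ take (y / 2) W)
    S₃ = chainEdges (x / 5) (y / 5) U st W ts

  module Counting (K : ℕ) (96≤K : 96 ≤ K) (192≤κ : 192 ≤ κ) (thick : ThickBound κ K) where

    private
      length-pairs : ∀ jl line jr → length (pairs (jl ++ line ++ jr)) ≡ width jl line jr * width jl line jr
      length-pairs jl line jr = trans (length-cartesianProduct W W) (cong₂ _*_ |W| |W|)
        where
        W = jl ++ line ++ jr
        |W| : length W ≡ width jl line jr
        |W| = trans (length-++ jl) (cong (length jl +_) (length-++ line))

      square-short : ∀ a m b → m ≤ 1 → 48 * ((a + (m + b)) * (a + (m + b))) ≤ K + κ * (a * a + b * b)
      square-short a m b m≤1 = begin
        48 * ((a + (m + b)) * (a + (m + b)))         ≤⟨ *-monoʳ-≤ 48 (*-mono-≤ w≤ w≤) ⟩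
        48 * ((a + b + 1) * (a + b + 1))             ≤⟨ *-monoʳ-≤ 48 ([a+b]²≤ (a + b) 1) ⟩
        48 * (2 * ((a + b) * (a + b) + 1))           ≤⟨ *-monoʳ-≤ 48 (*-monoʳ-≤ 2 (+-monoˡ-≤ 1 ([a+b]²≤ a b))) ⟩
        48 * (2 * (2 * (a * a + b * b) + 1))         ≡⟨ solveℕ 1 (λ q → con 48 :* (con 2 :* (con 2 :* q :+ con 1)) := con 96 :+ con 192 :* q) refl (a * a + b * b) ⟩
        96 + 192 * (a * a + b * b)                   ≤⟨ +-mono-≤ 96≤K (*-monoˡ-≤ (a * a + b * b) 192≤κ) ⟩
        K + κ * (a * a + b * b)                      ∎
        where
        open ≤-Reasoning
        open ℕ.+-*-Solver renaming (solve to solveℕ)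
        w≤ : a + (m + b) ≤ a + b + 1
        w≤ = begin
          a + (m + b) ≤⟨ +-monoʳ-≤ a (+-monoˡ-≤ b m≤1) ⟩
          a + (1 + b) ≡⟨ solveℕ 2 (λ a b → a :+ (con 1 :+ b) := a :+ b :+ con 1) refl a b ⟩
          a + b + 1   ∎

      clique-bound : ∀ i jl line jr →
        48 * (width jl line jr * width jl line jr) ≤ K + κ * (length jl * length jl + length jr * length jr) →
        48 * length (pairs (jl ++ line ++ jr)) + K
          ≤ 95 * (i * length line) + 2 * K * 2 ^ i + κ * (length jl * length jl + length jr * length jr)
      clique-bound i jl line jr le = begin
        48 * length (pairs (jl ++ line ++ jr)) + K  ≡⟨ cong (λ n → 48 * n + K) (length-pairs jl line jr) ⟩
        48 * (w * w) + K                            ≤⟨ +-monoˡ-≤ K le ⟩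
        K + κ * q + K                               ≡⟨ solveℕ 2 (λ K x → K :+ x :+ K := con 2 :* K :* con 1 :+ x) refl K (κ * q) ⟩
        2 * K * 1 + κ * q                           ≤⟨ +-monoˡ-≤ (κ * q) (≤-trans (*-monoʳ-≤ (2 * K) (m^n>0 2 i)) (m≤n+m _ (95 * (i * length line)))) ⟩
        95 * (i * length line) + 2 * K * 2 ^ i + κ * q ∎
        where
        open ≤-Reasoning
        open ℕ.+-*-Solver renaming (solve to solveℕ)
        w = width jl line jr
        q = length jl * length jl + length jr * length jr

    -- Scaled by 48, a level costs 95 per vertex of the line: 6 · 15 = 90 for the chain and 5 for
    -- the thinness budget. The potential κ(a² + b²) lets end stacks pay for cliques beside them,
    -- and 2K · 2^i covers the constants of at most 2^i cliques.
    length-edges : ∀ i jl line jr → length line ≤ 2 ^ i →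
      48 * length (edges i jl line jr) + K
        ≤ 95 * (i * length line) + 2 * K * 2 ^ i + κ * (length jl * length jl + length jr * length jr)
    length-edges zero jl line jr short = clique-bound 0 jl line jr (square-short (length jl) (length line) (length jr) short)
    length-edges (suc i) jl line jr short with
      (2 * κ + 48) * (stackSize jl line jr * stackSize jl line jr) + 90 * (length jl + length jr) ≤? 5 * length line
    ... | no ¬fits = clique-bound (suc i) jl line jr (thick (length jl) (length line) (length jr) ¬fits)
    ... | yes fits = begin
      48 * length (E ++ E₁ ++ E₂) + K
        ≤⟨ +-monoʳ-≤ _ (m≤m+n K K) ⟩
      48 * length (E ++ E₁ ++ E₂) + (K + K)
        ≡⟨ cong (λ n → 48 * n + (K + K)) (trans (length-++ E) (cong (length E +_) (length-++ E₁))) ⟩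
      48 * (length E + (length E₁ + length E₂)) + (K + K)
        ≡⟨ solveℕ 4 (λ e e₁ e₂ K → con 48 :* (e :+ (e₁ :+ e₂)) :+ (K :+ K) := con 6 :* (con 8 :* e) :+ ((con 48 :* e₁ :+ K) :+ (con 48 :* e₂ :+ K))) refl (length E) (length E₁) (length E₂) K ⟩
      6 * (8 * length E) + ((48 * length E₁ + K) + (48 * length E₂ + K))
        ≤⟨ +-mono-≤ (*-monoʳ-≤ 6 chain≤) (+-mono-≤
             (length-edges i jl L st (left≤ jl line jr fits short))
             (length-edges i st R jr (right≤ jl line jr fits short))) ⟩
      6 * (8 * (σ * σ) + 15 * ((a + m₁) + (m₂ + b))) +
      ((95 * (i * m₁) + 2 * K * 2 ^ i + κ * (a * a + σ * σ)) + (95 * (i * m₂) + 2 * K * 2 ^ i + κ * (σ * σ + b * b)))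
        ≡⟨ solveℕ 9 (λ σ a b m₁ m₂ i K P κ →
             con 6 :* (con 8 :* (σ :* σ) :+ con 15 :* ((a :+ m₁) :+ (m₂ :+ b))) :+
             ((con 95 :* (i :* m₁) :+ con 2 :* K :* P :+ κ :* (a :* a :+ σ :* σ)) :+ (con 95 :* (i :* m₂) :+ con 2 :* K :* P :+ κ :* (σ :* σ :+ b :* b)))
             := ((con 2 :* κ :+ con 48) :* (σ :* σ) :+ con 90 :* (a :+ b)) :+ (con 90 :+ con 95 :* i) :* (m₁ :+ m₂) :+ con 2 :* K :* (con 2 :* P) :+ κ :* (a :* a :+ b :* b))
             refl σ a b m₁ m₂ i K (2 ^ i) κ ⟩
      -- The first bracket is what thinness bounds: 48σ² for stars inside the stack, κσ² for the new
      -- stack in each of the two halves, and 90(a + b) for reaching into the end stacks.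
      ((2 * κ + 48) * (σ * σ) + 90 * (a + b)) + (90 + 95 * i) * (m₁ + m₂) + 2 * K * (2 * 2 ^ i) + κ * (a * a + b * b)
        ≤⟨ +-monoˡ-≤ (κ * (a * a + b * b)) (+-monoˡ-≤ (2 * K * (2 * 2 ^ i)) (+-mono-≤ fits′ (*-monoʳ-≤ (90 + 95 * i) (parts≤line jl line jr fits)))) ⟩
      5 * m + (90 + 95 * i) * m + 2 * K * (2 * 2 ^ i) + κ * (a * a + b * b)
        ≡⟨ cong (λ z → z + 2 * K * (2 * 2 ^ i) + κ * (a * a + b * b)) (solveℕ 2 (λ m i → con 5 :* m :+ (con 90 :+ con 95 :* i) :* m := con 95 :* (m :+ i :* m)) refl m i) ⟩
      95 * (m + i * m) + 2 * K * (2 * 2 ^ i) + κ * (a * a + b * b) ∎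
      where
      open ≤-Reasoning
      open ℕ.+-*-Solver renaming (solve to solveℕ)
      L  = leftPart jl line jr
      st = stack jl line jr
      R  = rightPart jl line jr
      E  = chainEdges (length (jl ++ L)) (length (R ++ jr)) (jl ++ L) st (R ++ jr) st
      E₁ = edges i jl L st
      E₂ = edges i st R jr
      a  = length jl
      b  = length jr
      m  = length line
      m₁ = length L
      m₂ = length R
      σ  = length st
      chain≤ : 8 * length E ≤ 8 * (σ * σ) + 15 * ((a + m₁) + (m₂ + b))
      chain≤ = subst₂ (λ x y → 8 * length E ≤ 8 * (σ * σ) + 15 * (x + y)) (length-++ jl) (length-++ R)
        (length-chain (length (jl ++ L)) (length (R ++ jr)) (jl ++ L) st (R ++ jr) st)
      fits′ : (2 * κ + 48) * (σ * σ) + 90 * (a + b) ≤ 5 * m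
      fits′ = subst (λ s → (2 * κ + 48) * (s * s) + 90 * (a + b) ≤ 5 * m) (sym (length-stack jl line jr fits)) fits

  -- The edge set yields a hub

  drop-++-≤ : ∀ k (xs ys : List V) → k ≤ length xs → drop k (xs ++ ys) ≡ drop k xs ++ ys
  drop-++-≤ zero    xs       ys _         = refl
  drop-++-≤ (suc k) (x ∷ xs) ys (s≤s k≤) = drop-++-≤ k xs ys k≤

  All-lastN : ∀ {P : V → Set} {x} us w → length w ≤ x → All P (lastN x (us ++ w)) → All P w
  All-lastN {P} {x} us w |w|≤x all = All.++⁻ʳ (drop k us) (subst (All P) (drop-++-≤ k us w k≤) all)
    where
    k = length (us ++ w) ∸ x
    k≤ : k ≤ length us
    k≤ = m≤n+o⇒m∸n≤o (length (us ++ w)) x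
      (subst₂ _≤_ (sym (length-++ us)) (+-comm (length us) x) (+-monoʳ-≤ (length us) |w|≤x))

  All-take : ∀ {P : V → Set} {y} s us → length s ≤ y → All P (take y (s ++ us)) → All P s
  All-take             []      us _          _         = []
  All-take {y = suc _} (_ ∷ s) us (s≤s |s|≤y) (p ∷ all) = p ∷ All-take s us |s|≤y all

  ++-length-≤⇒[] : ∀ (v w : List V) → length (v ++ w) ≤ length w → v ≡ []
  ++-length-≤⇒[] []      w _  = refl
  ++-length-≤⇒[] (_ ∷ v) w le = ⊥-elim (<-irrefl refl (≤-trans (s≤s (≤-trans (m≤n+m (length w) (length v)) (≤-reflexive (sym (length-++ v))))) le))

  ⟨_⟩⇒_ : List (V × V) → (V → V → Set) → Set
  ⟨ E ⟩⇒ C = ∀ {a b} → (a , b) ∈ E → C a b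

  module _ (Cov : V → V → Set) where
    open Hubs Cov

    module _ (jl L st R jr : List V) where

      -- Omitting vertices of `jl` may bring others of `jl` within distance `x` of the stack. This
      -- is harmless if all of `jl ++ L` is covered or if the last `x` places lie in `L`; hence the
      -- two alternatives on each side.
      reach : ∀ {τ} x y → x ≤ length L ⊎ length (jl ++ L) ≤ x → y ≤ length R ⊎ length (R ++ jr) ≤ y →
        All (Cov τ) (lastN x (jl ++ L)) → All (Cov τ) (take y (R ++ jr)) → Reach jl L R jr τ x y
      reach {τ} x y x-cut y-cut lasts takes = record { reachˡ = left x-cut ; reachʳ = right y-cut }
        where
        left : x ≤ length L ⊎ length (jl ++ L) ≤ x → ∀ {jl′} → jl′ ⊆ jl →
          ∀ w₁ w₂ → w₁ ++ w₂ ≡ jl′ ++ L → length w₂ ≤ x → All (Cov τ) w₂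
        left (inj₂ all≤x) {jl′} jl′⊆ w₁ w₂ eq _ = All.++⁻ʳ w₁ (subst (All (Cov τ)) (sym eq)
          (⊆.All-resp-⊆ (⊆.++⁺ jl′⊆ ⊆-refl) (subst (λ k → All (Cov τ) (drop k (jl ++ L))) (m≤n⇒m∸n≡0 all≤x) lasts)))
        left (inj₁ x≤L) {jl′} jl′⊆ w₁ w₂ eq |w₂|≤x with ++-split w₁ {us = jl′} eq
        ... | inj₂ (v , _ , refl) = All-lastN (jl ++ v) w₂ |w₂|≤x
          (subst (λ U → All (Cov τ) (lastN x U)) (sym (++-assoc jl v w₂)) lasts)
        ... | inj₁ (v , _ , refl) with ++-length-≤⇒[] v L (≤-trans |w₂|≤x x≤L)
        ... | refl = All-lastN jl L |w₂|≤x lasts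
        right : y ≤ length R ⊎ length (R ++ jr) ≤ y → ∀ {jr′} → jr′ ⊆ jr →
          ∀ s₁ s₂ → s₁ ++ s₂ ≡ R ++ jr′ → length s₁ ≤ y → All (Cov τ) s₁
        right (inj₂ all≤y) {jr′} jr′⊆ s₁ s₂ eq _ = All.++⁻ˡ s₁ (subst (All (Cov τ)) (sym eq)
          (⊆.All-resp-⊆ (⊆.++⁺ (⊆-refl {x = R}) jr′⊆) (subst (All (Cov τ)) (take-all y (R ++ jr) all≤y) takes)))
        right (inj₁ y≤R) {jr′} jr′⊆ s₁ s₂ eq |s₁|≤y with ++-split s₁ {us = R} eq
        ... | inj₁ (v , refl , _) = All-take s₁ (v ++ jr) |s₁|≤y
          (subst (λ W → All (Cov τ) (take y W)) (++-assoc s₁ v jr) takes)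
        ... | inj₂ (v , refl , _) with v | |s₁|≤y
        ... | [] | |R|≤y = subst (All (Cov τ)) (sym (++-identityʳ R))
          (All-take R jr (subst (_≤ y) (cong length (++-identityʳ R)) |R|≤y) takes)
        ... | a ∷ v | |Rv|≤y = ⊥-elim (<-irrefl refl (≤-trans (m<m+n (length R) (s≤s z≤n))
          (≤-trans (≤-reflexive (sym (length-++ R {a ∷ v}))) (≤-trans |Rv|≤y y≤R))))

      covers-star : ∀ τ X → ⟨ star τ X ⟩⇒ Cov → All (Cov τ) X
      covers-star τ X ⇒Cov = All.tabulate (λ b∈ → ⇒Cov (∈-map⁺ (τ ,_) b∈))

      -- `x < 5 ^ t` makes the left reach 0 once the `t` pairs are spent. Only the very first reach
      -- may enter the end stacks, and then it covers them entirely; from `x / 2` and `y / 2` on,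
      -- reaches stay inside `L` and `R`.
      chain : ∀ t x y ts → x < 5 ^ t → length ts ≡ t * 2 →
        x / 2 ≤ length L → x ≤ length L ⊎ length (jl ++ L) ≤ x →
        y / 2 ≤ length R → y ≤ length R ⊎ length (R ++ jr) ≤ y →
        ⟨ chainEdges x y (jl ++ L) st (R ++ jr) ts ⟩⇒ Cov → Chain jl L st R jr x y ts
      chain zero    zero    y ts _        _ _ _ _ _ _ = end
      chain zero    (suc _) y ts (s≤s ()) _ _ _ _ _ _
      chain (suc t) x y (τ₁ ∷ τ₂ ∷ ts) x< |ts| x/2≤ x-cut y/2≤ y-cut ⇒Cov = pair
        (All.++⁻ˡ st c₁)
        (reach x y x-cut y-cut (All.++⁻ˡ (lastN x U) (All.++⁻ʳ st c₁)) (All.++⁻ʳ (lastN x U) (All.++⁻ʳ st c₁)))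
        (All.++⁻ˡ st c₂)
        (reach (x / 2) (y / 2) (inj₁ x/2≤) (inj₁ y/2≤) (All.++⁻ˡ (lastN (x / 2) U) (All.++⁻ʳ st c₂)) (All.++⁻ʳ (lastN (x / 2) U) (All.++⁻ʳ st c₂)))
        (chain t (x / 5) (y / 5) ts (m<n*o⇒m/o<n (subst (x <_) (*-comm 5 (5 ^ t)) x<)) (suc-injective (suc-injective |ts|))
          (≤-trans (m/n≤m (x / 5) 2) x/5≤) (inj₁ x/5≤) (≤-trans (m/n≤m (y / 5) 2) y/5≤) (inj₁ y/5≤)
          (λ e∈ → ⇒Cov (∈-++⁺ʳ S₁ (∈-++⁺ʳ S₂ e∈))))
        where
        U = jl ++ L
        W = R ++ jr
        S₁ = star τ₁ (st ++ lastN x U ++ take y W)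
        S₂ = star τ₂ (st ++ lastN (x / 2) U ++ take (y / 2) W)
        c₁ = covers-star τ₁ (st ++ lastN x U ++ take y W) (λ e∈ → ⇒Cov (∈-++⁺ˡ e∈))
        c₂ = covers-star τ₂ (st ++ lastN (x / 2) U ++ take (y / 2) W) (λ e∈ → ⇒Cov (∈-++⁺ʳ S₁ (∈-++⁺ˡ e∈)))
        x/5≤ : x / 5 ≤ length L
        x/5≤ = ≤-trans (/-monoʳ-≤ x (m≤m+n 2 3)) x/2≤
        y/5≤ : y / 5 ≤ length R
        y/5≤ = ≤-trans (/-monoʳ-≤ y (m≤m+n 2 3)) y/2≤

    hub : ∀ i jl line jr → ⟨ edges i jl line jr ⟩⇒ Cov → Hub jl line jr
    hub zero    jl line jr ⇒Cov = leaf (λ a∈ b∈ → ⇒Cov (∈-cartesianProduct⁺ a∈ b∈))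
    hub (suc i) jl line jr ⇒Cov with
      (2 * κ + 48) * (stackSize jl line jr * stackSize jl line jr) + 90 * (length jl + length jr) ≤? 5 * length line
    ... | no  _    = leaf (λ a∈ b∈ → ⇒Cov (∈-cartesianProduct⁺ a∈ b∈))
    ... | yes fits = subst (λ line → Hub jl line jr) (reassemble jl line jr fits)
      (node ≤-refl ≤-refl
        (chain jl L st R jr t x y st x<5^t (trans (length-stack jl line jr fits) (*-comm 2 t))
          (halves (length jl) (length L) (length-++ jl) (jl≤left jl line jr fits)) (inj₂ ≤-refl)
          (halves (length jr) (length R) (trans (length-++ R) (+-comm (length R) (length jr))) (jr≤right jl line jr fits)) (inj₂ ≤-refl)
          (λ e∈ → ⇒Cov (∈-++⁺ˡ e∈)))
        (hub i jl L st (λ e∈ → ⇒Cov (∈-++⁺ʳ E (∈-++⁺ˡ e∈))))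
        (hub i st R jr (λ e∈ → ⇒Cov (∈-++⁺ʳ E (∈-++⁺ʳ E₁ e∈)))))
      where
      L  = leftPart jl line jr
      st = stack jl line jr
      R  = rightPart jl line jr
      x  = length (jl ++ L)
      y  = length (R ++ jr)
      t  = bits (width jl line jr)
      E  = chainEdges x y (jl ++ L) st (R ++ jr) st
      E₁ = edges i jl L st
      halves : ∀ a m {z} → z ≡ a + m → a ≤ m → z / 2 ≤ m
      halves a m refl a≤m = subst ((a + m) / 2 ≤_) (m*n/n≡m m 2) (/-monoˡ-≤ 2
        (≤-trans (+-monoˡ-≤ m a≤m) (≤-reflexive (trans (cong (m +_) (sym (+-identityʳ m))) (*-comm 2 m)))))
      x<5^t : x < 5 ^ t
      x<5^t = begin-strict
        x                         ≡⟨ length-++ jl ⟩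
        length jl + length L      ≤⟨ +-monoʳ-≤ (length jl) (≤-trans (m≤m+n (length L) (length R)) (parts≤line jl line jr fits)) ⟩
        length jl + length line   ≤⟨ +-monoʳ-≤ (length jl) (m≤m+n (length line) (length jr)) ⟩
        width jl line jr          <⟨ <2^bits (width jl line jr) ⟩
        2 ^ t                     ≤⟨ ^-monoˡ-≤ t (m≤m+n 2 3) ⟩
        5 ^ t                     ∎
        where open ≤-Reasoning

-- Universality of the constructed graph

at : {A : Set} → A → (xs : List A) → Fin (suc (length xs)) → A
at a xs       Fin.zero    = a
at a (x ∷ xs) (Fin.suc i) = at x xs i

at-∈ : {A : Set} (a : A) (xs : List A) (i : Fin (suc (length xs))) → at a xs i ∈ a ∷ xs
at-∈ a xs       Fin.zero    = here refl
at-∈ a (x ∷ xs) (Fin.suc i) = there (at-∈ x xs i)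

at-injective : {A : Set} {a : A} {xs : List A} → Unique (a ∷ xs) → Injective _≡_ _≡_ (at a xs)
at-injective             _        {Fin.zero}  {Fin.zero}  _  = refl
at-injective {xs = x ∷ xs} (a∉ ∷ u) {Fin.zero}  {Fin.suc j} eq = ⊥-elim (All.lookup a∉ (at-∈ x xs j) eq)
at-injective {xs = x ∷ xs} (a∉ ∷ u) {Fin.suc i} {Fin.zero}  eq = ⊥-elim (All.lookup a∉ (at-∈ x xs i) (sym eq))
at-injective {xs = x ∷ xs} (a∉ ∷ u) {Fin.suc i} {Fin.suc j} eq = cong Fin.suc (at-injective u eq)

at-step : {A : Set} {R : A → A → Set} {a : A} {xs : List A} → Linked R (a ∷ xs) →
  ∀ i → R (at a xs (inject₁ i)) (at a xs (Fin.suc i))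
at-step {xs = x ∷ xs} (aRx ∷ _) Fin.zero    = aRx
at-step {xs = x ∷ xs} (_   ∷ l) (Fin.suc i) = at-step l i

at-last : {A : Set} (a : A) (xs : List A) (w : A) → at a (xs ++ w ∷ []) (fromℕ (length (xs ++ w ∷ []))) ≡ w
at-last a []       w = refl
at-last a (x ∷ xs) w = at-last x xs w

Linked-++⁻ˡ : {A : Set} {R : A → A → Set} (xs : List A) {ys : List A} → Linked R (xs ++ ys) → Linked R xs
Linked-++⁻ˡ []            _         = []
Linked-++⁻ˡ (x ∷ [])      _         = [-]
Linked-++⁻ˡ (x ∷ y ∷ xs) (r ∷ l) = r ∷ Linked-++⁻ˡ (y ∷ xs) l

Unique-⊆-length : {A : Set} (xs : List A) {ys : List A} → Unique xs → (∀ {x} → x ∈ xs → x ∈ ys) → length xs ≤ length ys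
Unique-⊆-length []       _        _   = z≤n
Unique-⊆-length (x ∷ xs) (x∉ ∷ u) xs⊆ with ∈-∃++ (xs⊆ (here refl))
... | us , vs , refl = ≤-trans (s≤s (Unique-⊆-length xs u rest)) (≤-reflexive (sym (↭-length (shift x us vs))))
  where
  rest : ∀ {y} → y ∈ xs → y ∈ us ++ vs
  rest y∈ with ∈-resp-↭ (shift x us vs) (xs⊆ (there y∈))
  ... | here refl = ⊥-elim (All.lookup x∉ y∈ refl)
  ... | there y∈′ = y∈′

Unique-map⇒injective : {A B : Set} (f : A → B) {xs : List A} → Unique (map f xs) →
  ∀ {x y} → x ∈ xs → y ∈ xs → f x ≡ f y → x ≡ y
Unique-map⇒injective f (_   ∷ _) (here refl) (here refl) _  = refl
Unique-map⇒injective f (f∉ ∷ _) (here refl) (there y∈)  eq = ⊥-elim (All.lookup f∉ (∈-map⁺ f y∈) eq)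
Unique-map⇒injective f (f∉ ∷ _) (there x∈)  (here refl) eq = ⊥-elim (All.lookup f∉ (∈-map⁺ f x∈) (sym eq))
Unique-map⇒injective f (_   ∷ u) (there x∈)  (there y∈)  eq = Unique-map⇒injective f u x∈ y∈ eq

module _ {n : ℕ} (H : Graph n) where

  Adj-sym : Symmetric (Adj H)
  Adj-sym {u} {v} = subst T (Graph.symm H u v)

  Adj-irrefl : ∀ {u} → ¬ Adj H u u
  Adj-irrefl {u} uu = subst T (Graph.irrefl H u) uu

  open Separation Fin._≟_ (Adj H) Adj-sym

  -- The list runs from the newest vertex backwards. Its segment from `v` to `w` is closed by their
  -- edge, and `u` in between makes it at least a triangle.
  close-cycle : ∀ {v u w rest} → Unique (v ∷ u ∷ rest) → Linked (Adj H) (v ∷ u ∷ rest) →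
    w ∈ rest → Adj H v w → Cycle H
  close-cycle {v} {u} {w} uniq linked w∈ vw with ∈-∃++ w∈
  ... | ys , zs , refl = build ys refl
    where
    reassoc = sym (++-assoc ys (w ∷ []) zs)
    uniq′   = proj₁ (Unique-++⁻ (v ∷ u ∷ ys ++ w ∷ []) (subst (λ xs → Unique (v ∷ u ∷ xs)) reassoc uniq))
    linked′ = Linked-++⁻ˡ (v ∷ u ∷ ys ++ w ∷ []) (subst (λ xs → Linked (Adj H) (v ∷ u ∷ xs)) reassoc linked)
    build : ∀ xs → xs ≡ ys → Cycle H
    build [] refl = record
      { len-3 = 0 ; vertex = at v (u ∷ w ∷ []) ; distinct = at-injective uniq′
      ; step = at-step linked′ ; close = Adj-sym vw }
    build (y ∷ ys′) refl = record
      { len-3 = length (ys′ ++ w ∷ []) ; vertex = at v (u ∷ y ∷ ys′ ++ w ∷ []) ; distinct = at-injective uniq′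
      ; step = at-step linked′ ; close = subst (λ z → Adj H z v) (sym (at-last y ys′ w)) (Adj-sym vw) }

  -- A non-backtracking walk inside g either gets stuck at a leaf or closes a cycle.
  walk : ¬ Cycle H → ∀ fuel g v u rest → suc n ≤ fuel + length (v ∷ u ∷ rest) →
    v ∈ g → Unique (v ∷ u ∷ rest) → Linked (Adj H) (v ∷ u ∷ rest) → HasLeaf g
  -- Without fuel the walk would have more than `n` distinct vertices.
  walk _ zero g v u rest n< _ uniq _ = ⊥-elim (<-irrefl refl (≤-trans n< (Fin.injective⇒≤ (at-injective uniq))))
  walk acyc (suc fuel) g v u rest n< v∈g uniq linked
    with any? (λ w → T? (adj H v w) ×-dec ¬? (w Fin.≟ u)) g
  ... | no none = v , v∈g , u , λ {w} w∈g vw →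
    decidable-stable (w Fin.≟ u) (λ w≢u → none (lose w∈g (vw , w≢u)))
  ... | yes some with find some
  ... | w , w∈g , vw , w≢u with any? (w Fin.≟_) rest
  ... | yes w∈rest = ⊥-elim (acyc (close-cycle uniq linked w∈rest vw))
  ... | no  w∉rest = walk acyc fuel g w v (u ∷ rest)
    (subst (suc n ≤_) (sym (+-suc fuel _)) n<) w∈g
    ((w≢v ∷ w≢u ∷ All.¬Any⇒All¬ rest w∉rest) ∷ uniq) (Adj-sym vw ∷ linked)
    where
    w≢v : w ≢ v
    w≢v refl = Adj-irrefl vw

  ¬Cycle⇒Acyclic : ¬ Cycle H → Acyclic
  ¬Cycle⇒Acyclic acyc []      _  g≢[] = ⊥-elim (g≢[] refl)
  ¬Cycle⇒Acyclic acyc g@(v ∷ vs) _ _ with any? (λ w → T? (adj H v w)) g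
  -- `v` is isolated in `g`, and the witness for its only neighbour is arbitrary.
  ... | no none = v , here refl , v , λ w∈g vw → ⊥-elim (none (lose w∈g vw))
  ... | yes some with find some
  ... | w , w∈g , vw = walk acyc n g w v [] (subst (_≤ n + 2) (+-comm n 1) (+-monoʳ-≤ n (m≤m+n 1 1))) w∈g
    ((w≢v ∷ []) ∷ [] ∷ []) (Adj-sym vw ∷ [-])
    where
    w≢v : w ≢ v
    w≢v refl = Adj-irrefl vw

module FromEdges {n : ℕ} (E : List (Fin n × Fin n)) where

  _∈E? : ∀ e → Dec (e ∈ E)
  e ∈E? = any? (Product.≡-dec Fin._≟_ Fin._≟_ e) E

  -- Stars and cliques also pair vertices with themselves; `u ≢ v` drops these loops.
  Joined : Fin n → Fin n → Set
  Joined u v = u ≢ v × ((u , v) ∈ E ⊎ (v , u) ∈ E)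

  joined? : ∀ u v → Dec (Joined u v)
  joined? u v = ¬? (u Fin.≟ v) ×-dec ((u , v) ∈E? ⊎-dec (v , u) ∈E?)

  Joined-sym : Symmetric Joined
  Joined-sym (u≢v , inj₁ uv) = u≢v ∘ sym , inj₂ uv
  Joined-sym (u≢v , inj₂ vu) = u≢v ∘ sym , inj₁ vu

  graph : Graph n
  graph = record
    { adj    = λ u v → ⌊ joined? u v ⌋
    ; symm   = λ u v → trans (isYes≗does (joined? u v))
        (trans (does-⇔ (mk⇔ Joined-sym Joined-sym) (joined? u v) (joined? v u)) (sym (isYes≗does (joined? v u))))
    ; irrefl = λ v → trans (isYes≗does (joined? v v)) (dec-false (joined? v v) (λ (v≢v , _) → v≢v refl))
    }

  orient : Fin n × Fin n → Fin n × Fin n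
  orient (u , v) with u Fin.<? v
  ... | yes _ = u , v
  ... | no  _ = v , u

  oriented : ∀ {u v} → u Fin.< v → (u , v) ∈ E ⊎ (v , u) ∈ E → (u , v) ∈ map orient E
  oriented {u} {v} u<v (inj₁ uv∈E) = subst (_∈ map orient E) kept (∈-map⁺ orient uv∈E)
    where
    kept : orient (u , v) ≡ (u , v)
    kept with u Fin.<? v
    ... | yes _  = refl
    ... | no u≮v = ⊥-elim (u≮v u<v)
  oriented {u} {v} u<v (inj₂ vu∈E) = subst (_∈ map orient E) flipped (∈-map⁺ orient vu∈E)
    where
    flipped : orient (v , u) ≡ (u , v)
    flipped with v Fin.<? u
    ... | yes v<u = ⊥-elim (<-asym u<v v<u)
    ... | no  _   = refl

  length-filter-≤ : {B : Set} {P : B → Set} (P? : ∀ b → Dec (P b)) {xs ys : List B} → Unique xs →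
    (∀ {b} → P b → b ∈ ys) → length (filter P? xs) ≤ length ys
  length-filter-≤ P? {xs} u P⇒∈ = Unique-⊆-length (filter P? xs) (Unique.filter⁺ P? u)
    (λ b∈ → P⇒∈ (proj₂ (∈-filter⁻ P? {xs = xs} b∈)))

  edgeCount≤ : edgeCount graph ≤ length E
  edgeCount≤ = subst (edgeCount graph ≤_) (length-map orient E)
    (length-filter-≤ _ (Unique.cartesianProduct⁺ (Unique.allFin⁺ n) (Unique.allFin⁺ n))
      (λ {(u , v)} (u<v , uv) → oriented u<v (proj₂ (toWitness {a? = joined? u v} uv))))

  Cov : Fin n → Fin n → Set
  Cov u v = u ≡ v ⊎ (u , v) ∈ E ⊎ (v , u) ∈ E

  Cov-sym : Symmetric Cov
  Cov-sym (inj₁ u≡v)       = inj₁ (sym u≡v)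
  Cov-sym (inj₂ (inj₁ uv)) = inj₂ (inj₂ uv)
  Cov-sym (inj₂ (inj₂ vu)) = inj₂ (inj₁ vu)

  universal : Hubs.Hub Cov [] (allFin n) [] → Universal (TreesOn n) graph
  universal hub {k} H (refl , tree) = f , injective , preserves
    where
    acyclic = ¬Cycle⇒Acyclic H (IsTree.acyclic tree)
    open Embedding Fin._≟_ (Adj H) (Adj-sym H) (Adj-irrefl H) acyclic Cov Cov-sym
    open Placement (hub-hosts hub ⊆-refl ⊆-refl [] (allFin n) [] refl (allFin n) (Unique.allFin⁺ n) refl)
    place : ∀ u → ∃[ p ] p ∈ pairs × u ≡ proj₁ p
    place u = ∈-map⁻ proj₁ (∈-resp-↭ (↭-sym labels) (∈-allFin u))
    f : Fin n → Fin n
    f u = proj₂ (proj₁ (place u))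
    injective : Injective _≡_ _≡_ f
    injective {u} {v} fu≡fv with place u | place v
    ... | p , p∈ , refl | q , q∈ , refl = cong proj₁
      (Unique-map⇒injective proj₂ (Unique-resp-↭ (↭-sym places) (Unique.allFin⁺ n)) p∈ q∈ fu≡fv)
    preserves : ∀ u v → Adj H u v → Adj graph (f u) (f v)
    preserves u v uv = fromWitness {a? = joined? (f u) (f v)} (fu≢fv , edge covered)
      where
      fu≢fv : f u ≢ f v
      fu≢fv eq = Adj-irrefl H (subst (Adj H u) (sym (injective eq)) uv)
      covered : Cov (f u) (f v)
      covered with place u | place v
      ... | p , p∈ , refl | q , q∈ , refl = covers p∈ q∈ uv
      edge : Cov (f u) (f v) → (f u , f v) ∈ E ⊎ (f v , f u) ∈ E
      edge (inj₁ eq) = ⊥-elim (fu≢fv eq)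
      edge (inj₂ e)  = e

-- The bound in terms of the logarithm

p<256*p : ∀ p .{{_ : NonZero p}} → p < 256 * p
p<256*p p = subst (p <_) (*-comm p 256) (m<m*n p 256 (m≤m+n 2 254))

-- 256 = 2⁸ serves both comparisons: depth 8(q + 1) accommodates n vertices, while 3^(5q) ≤ 256^q ≤
-- n. Rounding to this power costs at most eight levels, which is O(n) edges.
power-between : ∀ n .{{_ : NonZero n}} → ∃[ q ] 256 ^ q ≤ n × n < 256 ^ suc q
power-between (suc zero) = 0 , ≤-refl , m≤m+n 2 254
power-between (suc (suc n)) with power-between (suc n)
... | q , lower , upper with suc (suc n) <? 256 ^ suc q
... | yes lt = q , ≤-trans lower (n≤1+n _) , lt
... | no  ge = suc q , ≮⇒≥ ge
  , ≤-<-trans upper (p<256*p (256 ^ suc q) {{m^n≢0 256 (suc q)}})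

abstract
  κ₀ : ℕ
  κ₀ = 96 * (576 * 2)

  192≤κ₀ : 192 ≤ κ₀
  192≤κ₀ = m≤m+n 192 110400

  thick₀ : ∃[ K ] 96 ≤ K × ThickBound κ₀ K
  thick₀ = thick-small κ₀ ≤-refl

module UniversalSizeBound (n : ℕ) .{{_ : NonZero n}} (K : ℕ) (96≤K : 96 ≤ K) (thick : ThickBound κ₀ K) where

  bound : ∃[ q ] 3 ^ (5 * q) ≤ n ×
    (∀ m → s[ n ]≡ m → 6 * m ≤ 95 * (q * n) + 6 * ((95 + 64 * K) * n))
  bound with power-between n
  ... | q , lower , upper = q , 3^5q≤n , λ m (_ , least) → *-cancelˡ-≤ 8 (finish m (least (edgeCount graph) (graph , universal (hub Cov i [] (allFin n) [] ⇒Cov) , refl)))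
    where
    i = 8 * suc q
    open Construction {Fin n} κ₀
    E : List (Fin n × Fin n)
    E = edges i [] (allFin n) []
    open FromEdges E
    ⇒Cov : ⟨ E ⟩⇒ Cov
    ⇒Cov e∈ = inj₂ (inj₁ e∈)
    3^5q≤n : 3 ^ (5 * q) ≤ n
    3^5q≤n = begin
      3 ^ (5 * q)  ≡⟨ sym (^-*-assoc 3 5 q) ⟩
      243 ^ q      ≤⟨ ^-monoˡ-≤ q (m≤m+n 243 13) ⟩
      256 ^ q      ≤⟨ lower ⟩
      n            ∎
      where open ≤-Reasoning
    |line| : length (allFin n) ≡ n
    |line| = length-tabulate {n = n} id
    short : length (allFin n) ≤ 2 ^ i
    short = subst₂ _≤_ (sym |line|) (^-*-assoc 2 8 (suc q)) (<⇒≤ upper)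
    2^i≤ : 2 ^ i ≤ 256 * n
    2^i≤ = subst (_≤ 256 * n) (^-*-assoc 2 8 (suc q)) (*-monoʳ-≤ 256 lower)
    finish : ∀ m → m ≤ edgeCount graph → 8 * (6 * m) ≤ 8 * (95 * (q * n) + 6 * ((95 + 64 * K) * n))
    finish m m≤ = begin
      8 * (6 * m)                                              ≡⟨ sym (*-assoc 8 6 m) ⟩
      48 * m                                                   ≤⟨ *-monoʳ-≤ 48 (≤-trans m≤ edgeCount≤) ⟩
      48 * length E                                            ≤⟨ m≤m+n _ K ⟩
      48 * length E + K                                        ≤⟨ Counting.length-edges K 96≤K 192≤κ₀ thick i [] (allFin n) [] short ⟩
      95 * (i * length (allFin n)) + 2 * K * 2 ^ i + κ₀ * 0    ≡⟨ cong₂ (λ l z → 95 * (i * l) + 2 * K * 2 ^ i + z) |line| (*-zeroʳ κ₀) ⟩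
      95 * (i * n) + 2 * K * 2 ^ i + 0                         ≤⟨ +-monoˡ-≤ 0 (+-monoʳ-≤ (95 * (i * n)) (*-monoʳ-≤ (2 * K) 2^i≤)) ⟩
      -- The linear term 8(95 + 64K)n is raised sixfold so that the factor 6 of the left side can
      -- later be cancelled.
      95 * (i * n) + 2 * K * (256 * n) + 0                     ≤⟨ m≤m+n _ (8 * (5 * (95 * n)) + 2560 * (K * n)) ⟩
      95 * (i * n) + 2 * K * (256 * n) + 0 + (8 * (5 * (95 * n)) + 2560 * (K * n))
        ≡⟨ solveℕ 3 (λ q K n → con 95 :* (con 8 :* (con 1 :+ q) :* n) :+ con 2 :* K :* (con 256 :* n) :+ con 0 :+ (con 8 :* (con 5 :* (con 95 :* n)) :+ con 2560 :* (K :* n))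
             := con 8 :* (con 95 :* (q :* n) :+ con 6 :* ((con 95 :+ con 64 :* K) :* n))) refl q K n ⟩
      8 * (95 * (q * n) + 6 * ((95 + 64 * K) * n))             ∎
      where
      open ≤-Reasoning
      open ℕ.+-*-Solver renaming (solve to solveℕ)

size-bound : ∃[ C ] (∀ n .{{_ : NonZero n}} → ∃[ q ] 3 ^ (5 * q) ≤ n ×
  (∀ m → s[ n ]≡ m → 6 * m ≤ 95 * (q * n) + 6 * (C * n)))
size-bound with thick₀
... | K , 96≤K , thick = 95 + 64 * K , λ n → UniversalSizeBound.bound n K 96≤K thick

-- Riemann sums for the logarithm

module _ where
  open ℚ.≤-Reasoning

  ι : ℕ → ℚ
  ι a = ℤ.+ a ℚ./ 1

  private
    toℚᵘ-/ : ∀ a b → ℚ.toℚᵘ (ℤ.+ a ℚ./ suc b) ℚᵘ.≃ ℚᵘ.mkℚᵘ (ℤ.+ a) b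
    toℚᵘ-/ a b = ℚ.toℚᵘ-fromℚᵘ (ℚᵘ.mkℚᵘ (ℤ.+ a) b)

  ι-+ : ∀ a b → ι (a ℕ.+ b) ≡ ι a ℚ.+ ι b
  ι-+ a b = ℚ.toℚᵘ-injective (ℚᵘ.≃-trans (toℚᵘ-/ (a ℕ.+ b) 0) (ℚᵘ.≃-trans
    (ℚᵘ.*≡* (cong (ℤ._* ℤ.+ 1) (trans (ℤ.pos-+ a b) (sym (cong₂ ℤ._+_ (ℤ.*-identityʳ (ℤ.+ a)) (ℤ.*-identityʳ (ℤ.+ b)))))))
    (ℚᵘ.≃-trans (ℚᵘ.+-cong (ℚᵘ.≃-sym (toℚᵘ-/ a 0)) (ℚᵘ.≃-sym (toℚᵘ-/ b 0)))
                (ℚᵘ.≃-sym (ℚ.toℚᵘ-homo-+ (ι a) (ι b))))))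

  ι-* : ∀ a b → ι (a ℕ.* b) ≡ ι a ℚ.* ι b
  ι-* a b = ℚ.toℚᵘ-injective (ℚᵘ.≃-trans (toℚᵘ-/ (a ℕ.* b) 0) (ℚᵘ.≃-trans
    (ℚᵘ.*≡* (cong (ℤ._* ℤ.+ 1) (ℤ.pos-* a b)))
    (ℚᵘ.≃-trans (ℚᵘ.*-cong (ℚᵘ.≃-sym (toℚᵘ-/ a 0)) (ℚᵘ.≃-sym (toℚᵘ-/ b 0)))
                (ℚᵘ.≃-sym (ℚ.toℚᵘ-homo-* (ι a) (ι b))))))

  /-mono : ∀ a b c d → a ℕ.* suc d ℕ.≤ c ℕ.* suc b → ℤ.+ a ℚ./ suc b ℚ.≤ ℤ.+ c ℚ./ suc d
  /-mono a b c d le = ℚ.toℚᵘ-cancel-≤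
    (ℚᵘ.≤-respˡ-≃ (ℚᵘ.≃-sym (toℚᵘ-/ a b)) (ℚᵘ.≤-respʳ-≃ (ℚᵘ.≃-sym (toℚᵘ-/ c d))
      (ℚᵘ.*≤* (subst₂ ℤ._≤_ (ℤ.pos-* a (suc d)) (ℤ.pos-* c (suc b)) (ℤ.+≤+ le)))))

  ι-mono : ∀ {a b} → a ℕ.≤ b → ι a ℚ.≤ ι b
  ι-mono {a} {b} a≤b = /-mono a 0 b 0 (ℕ.*-monoˡ-≤ 1 a≤b)

  ι*inv : ∀ l d → ι l ℚ.* (ℤ.+ 1 ℚ./ suc d) ≡ ℤ.+ l ℚ./ suc d
  ι*inv l d = ℚ.toℚᵘ-injective (ℚᵘ.≃-trans (ℚ.toℚᵘ-homo-* (ι l) (ℤ.+ 1 ℚ./ suc d)) (ℚᵘ.≃-trans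
    (ℚᵘ.*-cong (toℚᵘ-/ l 0) (toℚᵘ-/ 1 d)) (ℚᵘ.≃-trans
    (ℚᵘ.*≡* (cong₂ ℤ._*_ (ℤ.*-identityʳ (ℤ.+ l)) (cong ℤ.+_ (sym (ℕ.+-identityʳ (suc d))))))
    (ℚᵘ.≃-sym (toℚᵘ-/ l d)))))

  0≤inv : ∀ d → ℚ.0ℚ ℚ.≤ ℤ.+ 1 ℚ./ suc d
  0≤inv d = /-mono 0 0 1 d z≤n

  sumRecip≥0 : ∀ a l → ℚ.0ℚ ℚ.≤ sumRecip a l
  sumRecip≥0 a zero    = ℚ.≤-refl
  sumRecip≥0 a (suc l) = ℚ.+-mono-≤ (0≤inv a) (sumRecip≥0 (suc a) l)

  sumRecip-++ : ∀ a l m → sumRecip a (l ℕ.+ m) ≡ sumRecip a l ℚ.+ sumRecip (a ℕ.+ l) m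
  sumRecip-++ a zero    m rewrite ℕ.+-identityʳ a = sym (ℚ.+-identityˡ (sumRecip a m))
  sumRecip-++ a (suc l) m rewrite sumRecip-++ (suc a) l m | ℕ.+-suc a l =
    sym (ℚ.+-assoc (ℤ.+ 1 ℚ./ suc a) (sumRecip (suc a) l) (sumRecip (suc (a ℕ.+ l)) m))

  sumRecip-monoʳ : ∀ a {l m} → l ℕ.≤ m → sumRecip a l ℚ.≤ sumRecip a m
  sumRecip-monoʳ a {l} {m} l≤m = begin
    sumRecip a l                                      ≡⟨ sym (ℚ.+-identityʳ (sumRecip a l)) ⟩
    sumRecip a l ℚ.+ ℚ.0ℚ                             ≤⟨ ℚ.+-monoʳ-≤ (sumRecip a l) (sumRecip≥0 (a ℕ.+ l) (m ℕ.∸ l)) ⟩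
    sumRecip a l ℚ.+ sumRecip (a ℕ.+ l) (m ℕ.∸ l)     ≡⟨ sym (sumRecip-++ a l (m ℕ.∸ l)) ⟩
    sumRecip a (l ℕ.+ (m ℕ.∸ l))                      ≡⟨ cong (sumRecip a) (ℕ.m+[n∸m]≡n l≤m) ⟩
    sumRecip a m                                      ∎

  sumRecip-lower : ∀ a l d → a ℕ.+ l ℕ.≤ suc d → ι l ℚ.* (ℤ.+ 1 ℚ./ suc d) ℚ.≤ sumRecip a l
  sumRecip-lower a zero    d _  = ℚ.≤-reflexive (ℚ.*-zeroˡ (ℤ.+ 1 ℚ./ suc d))
  sumRecip-lower a (suc l) d le = begin
    ι (suc l) ℚ.* u         ≡⟨ cong (ℚ._* u) (ι-+ 1 l) ⟩
    (ι 1 ℚ.+ ι l) ℚ.* u     ≡⟨ ℚ.*-distribʳ-+ u (ι 1) (ι l) ⟩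
    ι 1 ℚ.* u ℚ.+ ι l ℚ.* u ≡⟨ cong (ℚ._+ ι l ℚ.* u) (ℚ.*-identityˡ u) ⟩
    u ℚ.+ ι l ℚ.* u         ≤⟨ ℚ.+-mono-≤ (/-mono 1 d 1 a (ℕ.*-monoʳ-≤ 1 (ℕ.≤-trans (s≤s (ℕ.m≤m+n a l)) le′)))
                                          (sumRecip-lower (suc a) l d le′) ⟩
    sumRecip a (suc l)      ∎
    where
    u = ℤ.+ 1 ℚ./ suc d
    le′ : suc a ℕ.+ l ℕ.≤ suc d
    le′ = subst (ℕ._≤ suc d) (ℕ.+-suc a l) le

  -- 1/(a + 1) is X copies of 1/(X(a + 1)), and the X matching terms of the finer sum are at least
  -- as large: refining a right Riemann sum of a decreasing function increases it.
  sumRecip-scale : ∀ x a l → sumRecip a l ℚ.≤ sumRecip (suc x ℕ.* a) (suc x ℕ.* l)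
  sumRecip-scale x a zero rewrite ℕ.*-zeroʳ x = ℚ.≤-refl
  sumRecip-scale x a (suc l) = begin
    ℤ.+ 1 ℚ./ suc a ℚ.+ sumRecip (suc a) l
      ≤⟨ ℚ.+-mono-≤ block (sumRecip-scale x (suc a) l) ⟩
    sumRecip (X ℕ.* a) X ℚ.+ sumRecip (X ℕ.* suc a) (X ℕ.* l)
      ≡⟨ cong (λ b → sumRecip (X ℕ.* a) X ℚ.+ sumRecip b (X ℕ.* l)) (trans (ℕ.*-suc X a) (ℕ.+-comm X (X ℕ.* a))) ⟩
    sumRecip (X ℕ.* a) X ℚ.+ sumRecip (X ℕ.* a ℕ.+ X) (X ℕ.* l)
      ≡⟨ sym (sumRecip-++ (X ℕ.* a) X (X ℕ.* l)) ⟩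
    sumRecip (X ℕ.* a) (X ℕ.+ X ℕ.* l)
      ≡⟨ cong (sumRecip (X ℕ.* a)) (sym (ℕ.*-suc X l)) ⟩
    sumRecip (X ℕ.* a) (X ℕ.* suc l) ∎
    where
    X = suc x
    d = a ℕ.+ x ℕ.* suc a
    block : ℤ.+ 1 ℚ./ suc a ℚ.≤ sumRecip (X ℕ.* a) X
    block = begin
      ℤ.+ 1 ℚ./ suc a            ≤⟨ /-mono 1 a X d (ℕ.≤-reflexive (ℕ.*-identityˡ (X ℕ.* suc a))) ⟩
      ℤ.+ X ℚ./ suc d            ≡⟨ sym (ι*inv X d) ⟩
      ι X ℚ.* (ℤ.+ 1 ℚ./ suc d)  ≤⟨ sumRecip-lower (X ℕ.* a) X d (ℕ.≤-reflexive (trans (ℕ.+-comm (X ℕ.* a) X) (sym (ℕ.*-suc X a)))) ⟩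
      sumRecip (X ℕ.* a) X   ∎

  lnSeq-mono : ∀ {x y} k → x ℕ.≤ y → lnSeq x k ℚ.≤ lnSeq y k
  lnSeq-mono k x≤y = sumRecip-monoʳ (suc k) (ℕ.*-monoˡ-≤ (suc k) (ℕ.pred-mono-≤ x≤y))

  -- The terms of ln 3x beyond those of ln x cover the interval from x to 3x, and they form the sum
  -- for ln 3 refined x times.
  lnSeq-triple : ∀ x k .{{_ : NonZero x}} → lnSeq 3 k ℚ.+ lnSeq x k ℚ.≤ lnSeq (3 ℕ.* x) k
  lnSeq-triple (suc x) k = begin
    sumRecip M (2 ℕ.* M) ℚ.+ sumRecip M (x ℕ.* M)
      ≤⟨ ℚ.+-monoˡ-≤ (sumRecip M (x ℕ.* M)) (sumRecip-scale x M (2 ℕ.* M)) ⟩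
    sumRecip (suc x ℕ.* M) (suc x ℕ.* (2 ℕ.* M)) ℚ.+ sumRecip M (x ℕ.* M)
      ≡⟨ ℚ.+-comm _ (sumRecip M (x ℕ.* M)) ⟩
    sumRecip M (x ℕ.* M) ℚ.+ sumRecip (suc x ℕ.* M) (suc x ℕ.* (2 ℕ.* M))
      ≡⟨ sym (sumRecip-++ M (x ℕ.* M) (suc x ℕ.* (2 ℕ.* M))) ⟩
    sumRecip M (x ℕ.* M ℕ.+ suc x ℕ.* (2 ℕ.* M))
      ≡⟨ cong (sumRecip M) (solve 2 (λ x M → x :* M :+ (con 1 :+ x) :* (con 2 :* M) := (x :+ con 2 :* (con 1 :+ x)) :* M) refl x M) ⟩
    lnSeq (3 ℕ.* suc x) k ∎
    where
    M = suc k
    open ℕ.+-*-Solver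

  lnSeq-3^ : ∀ p k → ι p ℚ.* lnSeq 3 k ℚ.≤ lnSeq (3 ℕ.^ p) k
  lnSeq-3^ zero    k = ℚ.≤-reflexive (ℚ.*-zeroˡ (lnSeq 3 k))
  lnSeq-3^ (suc p) k = begin
    ι (suc p) ℚ.* l             ≡⟨ cong (ℚ._* l) (ι-+ 1 p) ⟩
    (ι 1 ℚ.+ ι p) ℚ.* l         ≡⟨ ℚ.*-distribʳ-+ l (ι 1) (ι p) ⟩
    ι 1 ℚ.* l ℚ.+ ι p ℚ.* l     ≡⟨ cong (ℚ._+ ι p ℚ.* l) (ℚ.*-identityˡ l) ⟩
    l ℚ.+ ι p ℚ.* l             ≤⟨ ℚ.+-monoʳ-≤ l (lnSeq-3^ p k) ⟩
    l ℚ.+ lnSeq (3 ℕ.^ p) k     ≤⟨ lnSeq-triple (3 ℕ.^ p) k {{ℕ.m^n≢0 3 p}} ⟩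
    lnSeq (3 ℕ.^ suc p) k       ∎
    where l = lnSeq 3 k

  0≤* : ∀ {p q} → ℚ.0ℚ ℚ.≤ p → ℚ.0ℚ ℚ.≤ q → ℚ.0ℚ ℚ.≤ p ℚ.* q
  0≤* {p} {q} 0≤p 0≤q = ℚ.≤-trans (ℚ.≤-reflexive (sym (ℚ.*-zeroʳ p)))
    (ℚ.*-monoˡ-≤-nonNeg p {{ℚ.nonNegative 0≤p}} 0≤q)

  cancel-reciprocal : ∀ (d e f q n r l c : ℚ) → r ℚ.* (f ℚ.* l) ≡ ℚ.1ℚ →
    (d ℚ.* e) ℚ.* (q ℚ.* n) ℚ.+ f ℚ.* c ≡ f ℚ.* (((d ℚ.* r) ℚ.* n) ℚ.* ((e ℚ.* q) ℚ.* l) ℚ.+ c)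
  cancel-reciprocal d e f q n r l c rfl≡1 = begin-equality
    (d ℚ.* e) ℚ.* (q ℚ.* n) ℚ.+ f ℚ.* c
      ≡⟨ cong (ℚ._+ f ℚ.* c) (sym (ℚ.*-identityʳ ((d ℚ.* e) ℚ.* (q ℚ.* n)))) ⟩
    (d ℚ.* e) ℚ.* (q ℚ.* n) ℚ.* ℚ.1ℚ ℚ.+ f ℚ.* c
      ≡⟨ cong (λ z → (d ℚ.* e) ℚ.* (q ℚ.* n) ℚ.* z ℚ.+ f ℚ.* c) (sym rfl≡1) ⟩
    (d ℚ.* e) ℚ.* (q ℚ.* n) ℚ.* (r ℚ.* (f ℚ.* l)) ℚ.+ f ℚ.* c
      ≡⟨ solve 8 (λ d e f q n r l c → (d :* e) :* (q :* n) :* (r :* (f :* l)) :+ f :* c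
           := f :* (((d :* r) :* n) :* ((e :* q) :* l) :+ c)) refl d e f q n r l c ⟩
    f ℚ.* (((d ℚ.* r) ℚ.* n) ℚ.* ((e ℚ.* q) ℚ.* l) ℚ.+ c) ∎
    where open ℚ.+-*-Solver

  -- For d = 19, e = 5, f = 6 and l = ln 3: if q ≤ log₃ n / 5, then 95 q n / 6 ≤ 19 / (6 ln 3) n ln n.
  leading-term : ∀ d e f q n C m r l ℓ → .{{_ : NonZero f}} → r ℚ.* (ι f ℚ.* l) ≡ ℚ.1ℚ → ℚ.0ℚ ℚ.≤ r →
    ι (e ℕ.* q) ℚ.* l ℚ.≤ ℓ → f ℕ.* m ℕ.≤ d ℕ.* e ℕ.* (q ℕ.* n) ℕ.+ f ℕ.* (C ℕ.* n) →
    ι m ℚ.≤ ((ι d ℚ.* r) ℚ.* ι n) ℚ.* ℓ ℚ.+ ι C ℚ.* ι n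
  leading-term d e f@(suc _) q n C m r l ℓ rfl≡1 0≤r ql≤ℓ fm≤ = ℚ.*-cancelˡ-≤-pos (ι f) {{ℚ.positive (ℚ.<-≤-trans (ℚ.positive⁻¹ (ι 1)) (ι-mono {1} {f} (s≤s z≤n)))}} (begin
    ι f ℚ.* ι m
      ≡⟨ sym (ι-* f m) ⟩
    ι (f ℕ.* m)
      ≤⟨ ι-mono fm≤ ⟩
    ι (d ℕ.* e ℕ.* (q ℕ.* n) ℕ.+ f ℕ.* (C ℕ.* n))
      ≡⟨ trans (ι-+ (d ℕ.* e ℕ.* (q ℕ.* n)) (f ℕ.* (C ℕ.* n)))
           (cong₂ ℚ._+_ (trans (ι-* (d ℕ.* e) (q ℕ.* n)) (cong₂ ℚ._*_ (ι-* d e) (ι-* q n)))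
                        (trans (ι-* f (C ℕ.* n)) (cong (ι f ℚ.*_) (ι-* C n)))) ⟩
    (ι d ℚ.* ι e) ℚ.* (ι q ℚ.* ι n) ℚ.+ ι f ℚ.* (ι C ℚ.* ι n)
      ≡⟨ cancel-reciprocal (ι d) (ι e) (ι f) (ι q) (ι n) r l (ι C ℚ.* ι n) rfl≡1 ⟩
    ι f ℚ.* (w ℚ.* ((ι e ℚ.* ι q) ℚ.* l) ℚ.+ ι C ℚ.* ι n)
      ≡⟨ cong (λ z → ι f ℚ.* (w ℚ.* (z ℚ.* l) ℚ.+ ι C ℚ.* ι n)) (sym (ι-* e q)) ⟩
    ι f ℚ.* (w ℚ.* (ι (e ℕ.* q) ℚ.* l) ℚ.+ ι C ℚ.* ι n)
      ≤⟨ ℚ.*-monoˡ-≤-nonNeg (ι f) {{ℚ.nonNegative (ι-mono {0} {f} z≤n)}}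
           (ℚ.+-monoˡ-≤ (ι C ℚ.* ι n) (ℚ.*-monoˡ-≤-nonNeg w {{ℚ.nonNegative 0≤w}} ql≤ℓ)) ⟩
    ι f ℚ.* (w ℚ.* ℓ ℚ.+ ι C ℚ.* ι n) ∎)
    where
    w = (ι d ℚ.* r) ℚ.* ι n
    0≤w : ℚ.0ℚ ℚ.≤ w
    0≤w = 0≤* (0≤* (ι-mono {0} {d} z≤n) 0≤r) (ι-mono {0} {n} z≤n)

6ln3 : ℕ → ℚ
6ln3 k = ι 6 ℚ.* lnSeq 3 k

module _ (k : ℕ) where
  open Positiveᴿ 6ln3-positive

  6ln3>0 : ℚ.0ℚ ℚ.< 6ln3 k
  6ln3>0 = ℚ.<-≤-trans bound>0 (bound≤ k)

  1/6ln3 : ℚ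
  1/6ln3 = (ℚ.1/ 6ln3 k) {{seq-nonZero k}}

  1/6ln3≥0 : ℚ.0ℚ ℚ.≤ 1/6ln3
  1/6ln3≥0 = ℚ.<⇒≤ (ℚ.positive⁻¹ 1/6ln3 {{ℚ.1/pos⇒pos (6ln3 k) {{ℚ.positive 6ln3>0}}}})

  1/6ln3-inverse : 1/6ln3 ℚ.* 6ln3 k ≡ ℚ.1ℚ
  1/6ln3-inverse = ℚ.*-inverseˡ (6ln3 k) {{seq-nonZero k}}

  -- From 3^(5q) ≤ n, the inequality 5q ln 3 ≤ ln n holds already between the k-th approximations,
  -- so the real bound reduces to one between rationals at every index.
  size-bound-at : ∀ n q C m → 3 ^ (5 * q) ≤ n → 6 * m ≤ 95 * (q * n) + 6 * (C * n) →
    ι m ℚ.≤ ((ι 19 ℚ.* 1/6ln3) ℚ.* ι n) ℚ.* lnSeq n k ℚ.+ ι C ℚ.* ι n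
  size-bound-at n q C m 3^5q≤n = leading-term 19 5 6 q n C m 1/6ln3 (lnSeq 3 k) (lnSeq n k) 1/6ln3-inverse 1/6ln3≥0
    (ℚ.≤-trans (lnSeq-3^ (5 * q) k) (lnSeq-mono k 3^5q≤n))

p≤q⇒p≤q+ε : ∀ {p q ε} → ℚ.0ℚ ℚ.< ε → p ℚ.≤ q → p ℚ.≤ q ℚ.+ ε
p≤q⇒p≤q+ε {q = q} 0<ε p≤q = ℚ.≤-trans p≤q (ℚ.≤-trans (ℚ.≤-reflexive (sym (ℚ.+-identityʳ q))) (ℚ.+-monoʳ-≤ q (ℚ.<⇒≤ 0<ε)))

theorem1 : Σ[ C ∈ ℝ ] Σ[ N ∈ ℕ ] (∀ n .{{_ : NonZero n}} → N ≤ n → ∀ m → s[ n ]≡ m →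
    fromℕᴿ m ≤ᴿ fromℕᴿ 19 ÷ᴿ (fromℕᴿ 6 *ᴿ ln 3) *ᴿ fromℕᴿ n *ᴿ ln n +ᴿ C *ᴿ fromℕᴿ n)
theorem1 = fromℕᴿ (proj₁ size-bound) , 1 , λ n _ m s≡m ε 0<ε →
  let q , 3^5q≤n , size≤ = proj₂ size-bound n
  in 0 , λ k _ → p≤q⇒p≤q+ε 0<ε (size-bound-at k n q (proj₁ size-bound) m 3^5q≤n (size≤ m s≡m))
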